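{- Let $n \ge k \ge 3$ be integers and let $m = \lceil (n-k)/2 \rceil$. Then \[ \mathrm{La}_{\mathrm{c}}(n, Y_k, Y'_k) = 2^{n} - S(n,k,m). \]
   Context: For integers $k\ge 2$ and $r$, $S(n,k,r) = \sum_{0\le i\le n,\ i \equiv r \pmod k}\binom{n}{i}$. For $k\ge 2$, a family $\mathcal{F}$ of subsets of $[n]=\{1,\dots,n\}$ contains a copy of $Y_k$ on consecutive levels if it contains $k+1$ distinct sets $F_1, F_2, G_1, \ldots, G_{k-1}$ with $G_1\subset G_2 \subset \cdots \subset G_{k-1} \subset F_1$, $G_{k-1}\subset F_2$, and $|F_1| = |F_2| = |G_{k-1}|+1 = |G_{k-2}|+2 = \cdots = |G_1|+k-1$. It contains a copy of $Y'_k$ on consecutive levels if it contains $k+1$ distinct sets $F_1,F_2,G_1,\ldots,G_{k-1}$ with $G_1\supset G_2\supset\cdots\supset G_{k-1}\supset F_1$, $G_{k-1}\supset F_2$, and $|F_1|=|F_2|=|G_{k-1}|-1=\cdots=|G_1|-(k-1)$. $\mathrm{La}_{\mathrm{c}}(n, Y_k, Y'_k)$ denotes the maximum size of a family of subsets of $[n]$ containing neither a copy of $Y_k$ nor a copy of $Y'_k$ on consecutive levels. -}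

module Defs where

open import Data.Nat using (ℕ; zero; suc; _+_; _∸_; _<_; _≤_; _^_)
open import Data.Nat.DivMod using (_/_; _%_)
open import Data.Nat.Combinatorics using (_C_)
open import Data.Bool using (Bool; true; false; if_then_else_)
open import Data.Vec using (Vec; []; _∷_)
open import Data.List using (List; []; _∷_; map; _++_)
open import Data.Fin.Subset using (Subset; _⊂_; ∣_∣)
open import Data.Product using (_×_; Σ; ∃)
open import Relation.Binary.PropositionalEquality using (_≡_; _≢_)
open import Relation.Nullary using (¬_)

S : ℕ → ℕ → ℕ → ℕ
S n zero r = 0   -- unused (k ≥ 2 in all uses)
S n (suc zero) r = 0  -- unused
S n k@(suc (suc j)) r = go (suc n)
  where
  go : ℕ → ℕ
  go zero = 0
  go (suc i) with (i % k) Data.Nat.≟ (r % k)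
  ... | Relation.Nullary.yes _ = n C i + go i
  ... | Relation.Nullary.no _ = go i

Family : ℕ → Set
Family n = Subset n → Bool

_∈F_ : ∀ {n} → Subset n → Family n → Set
A ∈F 𝓕 = 𝓕 A ≡ true

allSubsets : (n : ℕ) → List (Subset n)
allSubsets zero = [] ∷ []
allSubsets (suc n) = map (true ∷_) (allSubsets n) ++ map (false ∷_) (allSubsets n)

countList : ∀ {n} → Family n → List (Subset n) → ℕ
countList 𝓕 [] = 0
countList 𝓕 (A ∷ As) = (if 𝓕 A then 1 else 0) + countList 𝓕 As

size : ∀ {n} → Family n → ℕ
size {n} 𝓕 = countList 𝓕 (allSubsets n)

-- 𝓕 contains a copy of Y_k on consecutive levels.
-- The chain G_1 ⊂ … ⊂ G_{k-1} is G 0, …, G (k ∸ 2) (0-based: G i is G_{i+1}).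
ContainsY : ∀ {n} → ℕ → Family n → Set
ContainsY {n} k 𝓕 =
  Σ (Subset n) λ F₁ → Σ (Subset n) λ F₂ → Σ (ℕ → Subset n) λ G →
    (F₁ ∈F 𝓕) × (F₂ ∈F 𝓕) × (∀ i → i < k ∸ 1 → G i ∈F 𝓕)
    × (F₁ ≢ F₂)
    × (∀ i → i < k ∸ 1 → (G i ≢ F₁) × (G i ≢ F₂))
    × (∀ i j → i < k ∸ 1 → j < k ∸ 1 → i ≢ j → G i ≢ G j)
    × (∀ i → suc i < k ∸ 1 → G i ⊂ G (suc i))
    × (G (k ∸ 2) ⊂ F₁) × (G (k ∸ 2) ⊂ F₂)
    × (∣ F₁ ∣ ≡ ∣ F₂ ∣)
    × (∀ i → i < k ∸ 1 → ∣ G i ∣ + (k ∸ 1 ∸ i) ≡ ∣ F₁ ∣)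

ContainsY' : ∀ {n} → ℕ → Family n → Set
ContainsY' {n} k 𝓕 =
  Σ (Subset n) λ F₁ → Σ (Subset n) λ F₂ → Σ (ℕ → Subset n) λ G →
    (F₁ ∈F 𝓕) × (F₂ ∈F 𝓕) × (∀ i → i < k ∸ 1 → G i ∈F 𝓕)
    × (F₁ ≢ F₂)
    × (∀ i → i < k ∸ 1 → (G i ≢ F₁) × (G i ≢ F₂))
    × (∀ i j → i < k ∸ 1 → j < k ∸ 1 → i ≢ j → G i ≢ G j)
    × (∀ i → suc i < k ∸ 1 → G (suc i) ⊂ G i)
    × (F₁ ⊂ G (k ∸ 2)) × (F₂ ⊂ G (k ∸ 2))
    × (∣ F₁ ∣ ≡ ∣ F₂ ∣)
    × (∀ i → i < k ∸ 1 → ∣ G i ∣ ≡ ∣ F₁ ∣ + (k ∸ 1 ∸ i))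

Free : ∀ {n} → ℕ → Family n → Set
Free k 𝓕 = ¬ ContainsY k 𝓕 × ¬ ContainsY' k 𝓕

IsLac : ℕ → ℕ → ℕ → Set
IsLac n k v =
  (Σ (Family n) λ 𝓕 → Free k 𝓕 × size 𝓕 ≡ v)
  × (∀ (𝓕 : Family n) → Free k 𝓕 → size 𝓕 ≤ v)

ceilHalf : ℕ → ℕ
ceilHalf x = (x + 1) / 2

{-# OPTIONS --safe #-}

-- A family without the levels ≡ m (mod k) is free, since k consecutive levels meet
-- every residue class.
--
-- For the upper bound weight a missing set on level i by i! (n − i)!, the number of
-- maximal chains through it.  Take a saturated chain of 𝓕 on the levels a+1, …, a+k−2,
-- let p and q be the numbers of lower covers of its bottom and of upper covers of its
-- top, and u and v the numbers of those covers that lie in 𝓕.  Freeness leaves only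
-- u = 0, v = 0 or u = v = 1, so u/p + v/q ≤ 1 as soon as p, q ≥ 2; averaging over all
-- chains, the levels a, …, a+k−1 carry missing weight at least n!.  If p = 1 or q = 1,
-- that is, for the bottom and the top window only, the loss is at most n!/(n−k+2).
-- Linear programming duality turns these window inequalities into a bound on the
-- number of missing sets, the optimum being S(n,k,m) because S(n,k,·) is unimodal on
-- the residues and minimal at m.  The two boundary losses cost less than one set if
-- n > k, and integrality removes them; n = k is treated by hand.
module Submission where

open import Defs
open import Data.Bool using (Bool; true; false; if_then_else_; not)
open import Data.Empty using (⊥-elim)
open import Data.Fin as Fin using ()
open import Data.Fin.Subset using (Subset; _⊂_; ∣_∣)
open import Data.List using ([]; _∷_; _++_; map)
open import Data.Nat
open import Data.Nat.Combinatorics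
  using (_C_; nCk+nC[k+1]≡[n+1]C[k+1]; nCk≡nC[n∸k]; nCn≡1; k>n⇒nCk≡0)
open import Data.Nat.DivMod
  using (_%_; _/_; %-distribˡ-+; [m+n]%n≡m%n; [m+kn]%n≡m%n; m≡m%n+[m/n]*n; m<n⇒m%n≡m;
         m*n%n≡0; m%n%n≡m%n; m%n<n; n%n≡0)
open import Data.Nat.Properties
open import Data.Nat.Tactic.RingSolver using (solve-∀)
open import Data.Product using (_×_; _,_; ∃; ∃₂; proj₁; proj₂)
open import Data.Sum using (_⊎_; inj₁; inj₂)
open import Data.Vec using ([]; _∷_; here; there)
open import Function using (_∘_)
open import Relation.Binary.PropositionalEquality
open import Relation.Nullary using (¬_; yes; no; contradiction)

-- Finite sums and sums over levels of the Boolean lattice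

Σ< : ℕ → (ℕ → ℕ) → ℕ
Σ< zero f = 0
Σ< (suc n) f = f 0 + Σ< n (f ∘ suc)

Σ<-cong : ∀ n {f g} → (∀ i → i < n → f i ≡ g i) → Σ< n f ≡ Σ< n g
Σ<-cong zero h = refl
Σ<-cong (suc n) h = cong₂ _+_ (h 0 z<s) (Σ<-cong n λ i i<n → h (suc i) (s<s i<n))

Σ<-mono : ∀ n {f g} → (∀ i → i < n → f i ≤ g i) → Σ< n f ≤ Σ< n g
Σ<-mono zero h = z≤n
Σ<-mono (suc n) h = +-mono-≤ (h 0 z<s) (Σ<-mono n λ i i<n → h (suc i) (s<s i<n))

Σ<-zero : ∀ n {f} → (∀ i → i < n → f i ≡ 0) → Σ< n f ≡ 0
Σ<-zero zero h = refl
Σ<-zero (suc n) h = cong₂ _+_ (h 0 z<s) (Σ<-zero n λ i i<n → h (suc i) (s<s i<n))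

Σ<-+ : ∀ n f g → Σ< n (λ i → f i + g i) ≡ Σ< n f + Σ< n g
Σ<-+ zero f g = refl
Σ<-+ (suc n) f g rewrite Σ<-+ n (f ∘ suc) (g ∘ suc) =
  lemma (f 0) (g 0) (Σ< n (f ∘ suc)) (Σ< n (g ∘ suc))
  where
  lemma : ∀ a b c d → a + b + (c + d) ≡ a + c + (b + d)
  lemma = solve-∀

Σ<-* : ∀ n c f → Σ< n (λ i → c * f i) ≡ c * Σ< n f
Σ<-* zero c f = sym (*-zeroʳ c)
Σ<-* (suc n) c f rewrite Σ<-* n c (f ∘ suc) = sym (*-distribˡ-+ c (f 0) _)

Σ<-linear : ∀ n c f d g → Σ< n (λ i → c * f i + d * g i) ≡ c * Σ< n f + d * Σ< n g
Σ<-linear n c f d g = trans (Σ<-+ n (λ i → c * f i) (λ i → d * g i)) (cong₂ _+_ (Σ<-* n c f) (Σ<-* n d g))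

Σ<-split : ∀ a b f → Σ< (a + b) f ≡ Σ< a f + Σ< b (λ j → f (a + j))
Σ<-split zero b f = refl
Σ<-split (suc a) b f rewrite Σ<-split a b (f ∘ suc) = sym (+-assoc (f 0) _ _)

Σ<-snoc : ∀ n f → Σ< (suc n) f ≡ Σ< n f + f n
Σ<-snoc zero f = +-comm (f 0) 0
Σ<-snoc (suc n) f rewrite Σ<-snoc n (f ∘ suc) = sym (+-assoc (f 0) _ _)

Σ<-reverse : ∀ n (f : ℕ → ℕ) → Σ< n (λ j → f (suc j)) ≡ Σ< n (λ j → f (n ∸ j))
Σ<-reverse zero f = refl
Σ<-reverse (suc n) f = begin
  Σ< (suc n) (f ∘ suc)             ≡⟨ Σ<-snoc n (f ∘ suc) ⟩
  Σ< n (f ∘ suc) + f (suc n)       ≡⟨ cong (_+ f (suc n)) (Σ<-reverse n f) ⟩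
  Σ< n (λ j → f (n ∸ j)) + f (suc n) ≡⟨ +-comm _ (f (suc n)) ⟩
  f (suc n) + Σ< n (λ j → f (n ∸ j)) ∎
  where open ≡-Reasoning

Σ<-swap : ∀ m n (f : ℕ → ℕ → ℕ) →
  Σ< m (λ i → Σ< n (f i)) ≡ Σ< n (λ j → Σ< m (λ i → f i j))
Σ<-swap zero n f = sym (Σ<-zero n λ _ _ → refl)
Σ<-swap (suc m) n f rewrite Σ<-swap m n (f ∘ suc) = sym (Σ<-+ n (f 0) _)

total : ∀ {n} → (Subset n → ℕ) → ℕ
total {zero} f = f []
total {suc n} f = total (f ∘ (true ∷_)) + total (f ∘ (false ∷_))

levelSum : ∀ {n} → ℕ → (Subset n → ℕ) → ℕ
levelSum {zero} zero f = f []
levelSum {zero} (suc i) f = 0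
levelSum {suc n} zero f = levelSum zero (f ∘ (false ∷_))
levelSum {suc n} (suc i) f =
  levelSum i (f ∘ (true ∷_)) + levelSum (suc i) (f ∘ (false ∷_))

levelSum-> : ∀ {n} i (f : Subset n → ℕ) → n < i → levelSum i f ≡ 0
levelSum-> {zero} (suc i) f _ = refl
levelSum-> {suc n} (suc i) f (s≤s n<i) =
  cong₂ _+_ (levelSum-> i _ n<i) (levelSum-> (suc i) _ (m≤n⇒m≤1+n n<i))

Σ-levelSum : ∀ {n} (f : Subset n → ℕ) → Σ< (suc n) (λ i → levelSum i f) ≡ total f
Σ-levelSum {zero} f = +-identityʳ (f [])
Σ-levelSum {suc n} f = begin
  L₀ + Σ< (suc n) (λ i → levelSum i fₜ + levelSum (suc i) f₀)
    ≡⟨ cong (L₀ +_) (Σ<-+ (suc n) (λ i → levelSum i fₜ) (λ i → levelSum (suc i) f₀)) ⟩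
  L₀ + (Σ< (suc n) (λ i → levelSum i fₜ) + Σ< (suc n) (λ i → levelSum (suc i) f₀))
    ≡⟨ cong₂ (λ a b → L₀ + (a + b)) (Σ-levelSum fₜ) (Σ<-snoc n _) ⟩
  L₀ + (total fₜ + (Σ< n (λ i → levelSum (suc i) f₀) + levelSum (suc n) f₀))
    ≡⟨ cong (λ a → L₀ + (total fₜ + (Σ< n (λ i → levelSum (suc i) f₀) + a)))
         (levelSum-> (suc n) f₀ ≤-refl) ⟩
  L₀ + (total fₜ + (Σ< n (λ i → levelSum (suc i) f₀) + 0))
    ≡⟨ shuffle L₀ (total fₜ) _ ⟩
  total fₜ + Σ< (suc n) (λ i → levelSum i f₀)
    ≡⟨ cong (total fₜ +_) (Σ-levelSum f₀) ⟩
  total fₜ + total f₀ ∎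
  where
  open ≡-Reasoning
  fₜ = f ∘ (true ∷_)
  f₀ = f ∘ (false ∷_)
  L₀ = levelSum 0 f₀
  shuffle : ∀ a b c → a + (b + (c + 0)) ≡ b + (a + c)
  shuffle = solve-∀

levelSum-mono : ∀ {n} i {f g : Subset n → ℕ} →
  (∀ A → ∣ A ∣ ≡ i → f A ≤ g A) → levelSum i f ≤ levelSum i g
levelSum-mono {zero} zero h = h [] refl
levelSum-mono {zero} (suc i) h = z≤n
levelSum-mono {suc n} zero h = levelSum-mono zero λ A → h (false ∷ A)
levelSum-mono {suc n} (suc i) h =
  +-mono-≤ (levelSum-mono i λ A e → h (true ∷ A) (cong suc e))
           (levelSum-mono (suc i) λ A → h (false ∷ A))

levelSum-cong : ∀ {n} i {f g : Subset n → ℕ} →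
  (∀ A → ∣ A ∣ ≡ i → f A ≡ g A) → levelSum i f ≡ levelSum i g
levelSum-cong i h = ≤-antisym (levelSum-mono i λ A e → ≤-reflexive (h A e))
                              (levelSum-mono i λ A e → ≤-reflexive (sym (h A e)))

levelSum-+ : ∀ {n} i (f g : Subset n → ℕ) →
  levelSum i (λ A → f A + g A) ≡ levelSum i f + levelSum i g
levelSum-+ {zero} zero f g = refl
levelSum-+ {zero} (suc i) f g = refl
levelSum-+ {suc n} zero f g = levelSum-+ zero (f ∘ (false ∷_)) (g ∘ (false ∷_))
levelSum-+ {suc n} (suc i) f g
  rewrite levelSum-+ i (f ∘ (true ∷_)) (g ∘ (true ∷_))
        | levelSum-+ (suc i) (f ∘ (false ∷_)) (g ∘ (false ∷_)) =
  lemma (levelSum i (f ∘ (true ∷_))) _ _ _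
  where
  lemma : ∀ a b c d → a + b + (c + d) ≡ a + c + (b + d)
  lemma = solve-∀

levelSum-* : ∀ {n} i c (f : Subset n → ℕ) →
  levelSum i (λ A → c * f A) ≡ c * levelSum i f
levelSum-* {zero} zero c f = refl
levelSum-* {zero} (suc i) c f = sym (*-zeroʳ c)
levelSum-* {suc n} zero c f = levelSum-* zero c (f ∘ (false ∷_))
levelSum-* {suc n} (suc i) c f
  rewrite levelSum-* i c (f ∘ (true ∷_)) | levelSum-* (suc i) c (f ∘ (false ∷_)) =
  sym (*-distribˡ-+ c _ _)

nC0≡1 : ∀ n → n C 0 ≡ 1
nC0≡1 n = trans (nCk≡nC[n∸k] {0} {n} z≤n) (nCn≡1 n)

levelSum-const : ∀ n i c → levelSum {n} i (λ _ → c) ≡ (n C i) * c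
levelSum-const zero zero c = sym (*-identityˡ c)
levelSum-const zero (suc i) c = sym (cong (_* c) (k>n⇒nCk≡0 {0} {suc i} z<s))
levelSum-const (suc n) zero c = trans (levelSum-const n zero c)
  (cong (_* c) (trans (nC0≡1 n) (sym (nC0≡1 (suc n)))))
levelSum-const (suc n) (suc i) c
  rewrite levelSum-const n i c | levelSum-const n (suc i) c =
  trans (sym (*-distribʳ-+ c (n C i) _)) (cong (_* c) (nCk+nC[k+1]≡[n+1]C[k+1] n i))

-- Covers in the Boolean lattice and double counting

data _⋖_ : ∀ {n} → Subset n → Subset n → Set where
  add  : ∀ {n} {A : Subset n} → (false ∷ A) ⋖ (true ∷ A)
  keep : ∀ {n} {s} {A B : Subset n} → A ⋖ B → (s ∷ A) ⋖ (s ∷ B)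

⋖⇒card : ∀ {n} {A B : Subset n} → A ⋖ B → ∣ B ∣ ≡ suc ∣ A ∣
⋖⇒card add = refl
⋖⇒card (keep {s = true} c) = cong suc (⋖⇒card c)
⋖⇒card (keep {s = false} c) = ⋖⇒card c

⋖⇒⊂ : ∀ {n} {A B : Subset n} → A ⋖ B → A ⊂ B
⋖⇒⊂ add = (λ { (there x∈) → there x∈ }) , Fin.zero , here , λ ()
⋖⇒⊂ (keep c) with ⋖⇒⊂ c
... | A⊆B , x , x∈B , x∉A =
  (λ { here → here ; (there y∈) → there (A⊆B y∈) }) , Fin.suc x , there x∈B , λ { (there x∈A) → x∉A x∈A }

upSum : ∀ {n} → Subset n → (Subset n → ℕ) → ℕ
upSum [] f = 0
upSum (true ∷ A) f = upSum A (f ∘ (true ∷_))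
upSum (false ∷ A) f = f (true ∷ A) + upSum A (f ∘ (false ∷_))

downSum : ∀ {n} → Subset n → (Subset n → ℕ) → ℕ
downSum [] f = 0
downSum (true ∷ A) f = f (false ∷ A) + downSum A (f ∘ (true ∷_))
downSum (false ∷ A) f = downSum A (f ∘ (false ∷_))

upSum-mono : ∀ {n} (A : Subset n) {f g} → (∀ B → A ⋖ B → f B ≤ g B) → upSum A f ≤ upSum A g
upSum-mono [] h = z≤n
upSum-mono (true ∷ A) h = upSum-mono A λ B c → h (true ∷ B) (keep c)
upSum-mono (false ∷ A) h =
  +-mono-≤ (h (true ∷ A) add) (upSum-mono A λ B c → h (false ∷ B) (keep c))

upSum-+ : ∀ {n} (A : Subset n) f g → upSum A (λ B → f B + g B) ≡ upSum A f + upSum A g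
upSum-+ [] f g = refl
upSum-+ (true ∷ A) f g = upSum-+ A _ _
upSum-+ (false ∷ A) f g rewrite upSum-+ A (f ∘ (false ∷_)) (g ∘ (false ∷_)) =
  lemma (f (true ∷ A)) _ _ _
  where
  lemma : ∀ a b c d → a + b + (c + d) ≡ a + c + (b + d)
  lemma = solve-∀

downSum-+ : ∀ {n} (A : Subset n) f g → downSum A (λ B → f B + g B) ≡ downSum A f + downSum A g
downSum-+ [] f g = refl
downSum-+ (false ∷ A) f g = downSum-+ A _ _
downSum-+ (true ∷ A) f g rewrite downSum-+ A (f ∘ (true ∷_)) (g ∘ (true ∷_)) =
  lemma (f (false ∷ A)) _ _ _
  where
  lemma : ∀ a b c d → a + b + (c + d) ≡ a + c + (b + d)
  lemma = solve-∀

downSum-cong : ∀ {n} (A : Subset n) {f g} → (∀ B → f B ≡ g B) → downSum A f ≡ downSum A g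
downSum-cong [] h = refl
downSum-cong (true ∷ A) h =
  cong₂ _+_ (h (false ∷ A)) (downSum-cong A (h ∘ (true ∷_)))
downSum-cong (false ∷ A) h = downSum-cong A (h ∘ (false ∷_))

-- The term `∣ A ∣ * c` stands on the left so that the number n - |A| of upper covers is expressed
-- without truncated subtraction.
upSum-const : ∀ {n} (A : Subset n) c → ∣ A ∣ * c + upSum A (λ _ → c) ≡ n * c
upSum-const [] c = refl
upSum-const (true ∷ A) c = trans (+-assoc c _ _) (cong (c +_) (upSum-const A c))
upSum-const (false ∷ A) c = trans (lemma (∣ A ∣ * c) c _) (cong (c +_) (upSum-const A c))
  where
  lemma : ∀ a b d → a + (b + d) ≡ b + (a + d)
  lemma = solve-∀

upSum-const′ : ∀ {n} (A : Subset n) c {d} → ∣ A ∣ + d ≡ n → upSum A (λ _ → c) ≡ d * c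
upSum-const′ A c {d} e = +-cancelˡ-≡ (∣ A ∣ * c) _ _
  (trans (upSum-const A c) (trans (cong (_* c) (sym e)) (*-distribʳ-+ c ∣ A ∣ d)))

downSum-const : ∀ {n} (A : Subset n) c → downSum A (λ _ → c) ≡ ∣ A ∣ * c
downSum-const [] c = refl
downSum-const (true ∷ A) c = cong (c +_) (downSum-const A c)
downSum-const (false ∷ A) c = downSum-const A c

-- Double counting of the covering pairs between levels i and i + 1: every set on level i + 1 has i
-- + 1 lower covers.
levelSum-upSum : ∀ {n} i (f : Subset n → ℕ) →
  levelSum i (λ A → upSum A f) ≡ suc i * levelSum (suc i) f
levelSum-upSum {zero} zero f = refl
levelSum-upSum {zero} (suc i) f = sym (*-zeroʳ i)
levelSum-upSum {suc n} zero f
  rewrite levelSum-+ 0 (f ∘ (true ∷_)) (λ A → upSum A (f ∘ (false ∷_)))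
        | levelSum-upSum 0 (f ∘ (false ∷_)) =
  lemma (levelSum 0 (f ∘ (true ∷_))) _
  where
  lemma : ∀ a b → a + 1 * b ≡ 1 * (a + b)
  lemma = solve-∀
levelSum-upSum {suc n} (suc i) f
  rewrite levelSum-+ (suc i) (f ∘ (true ∷_)) (λ A → upSum A (f ∘ (false ∷_)))
        | levelSum-upSum i (f ∘ (true ∷_))
        | levelSum-upSum (suc i) (f ∘ (false ∷_)) =
  lemma i (levelSum (suc i) (f ∘ (true ∷_))) _
  where
  lemma : ∀ i a b → suc i * a + (a + suc (suc i) * b) ≡ suc (suc i) * (a + b)
  lemma = solve-∀

-- Both sides count the covering pairs between levels i and i + 1; this is `levelSum-upSum` for the
-- constant function 1.
choose-absorb : ∀ {n} i d → i + d ≡ n → suc i * (n C suc i) ≡ d * (n C i)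
choose-absorb {n} i d e = begin
  suc i * (n C suc i)                          ≡⟨ cong (suc i *_) (count (suc i)) ⟩
  suc i * levelSum {n} (suc i) (λ _ → 1)       ≡⟨ levelSum-upSum {n} i (λ _ → 1) ⟨
  levelSum {n} i (λ A → upSum A (λ _ → 1))     ≡⟨ levelSum-cong i (λ A ∣A∣≡i →
                                                   upSum-const′ A 1 (trans (cong (_+ d) ∣A∣≡i) e)) ⟩
  levelSum {n} i (λ _ → d * 1)                 ≡⟨ levelSum-* {n} i d (λ _ → 1) ⟩
  d * levelSum {n} i (λ _ → 1)                 ≡⟨ cong (d *_) (count i) ⟨
  d * (n C i)                                  ∎
  where
  open ≡-Reasoning
  count : ∀ j → n C j ≡ levelSum {n} j (λ _ → 1)
  count j = trans (sym (*-identityʳ (n C j))) (sym (levelSum-const n j 1))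

choose-! : ∀ {n} i d → i + d ≡ n → (n C i) * (i ! * d !) ≡ n !
choose-! {n} zero d refl = trans (cong (_* (1 * n !)) (nC0≡1 n)) (trans (+-identityʳ _) (+-identityʳ _))
choose-! {n} (suc i) d e = begin
  (n C suc i) * (suc i * i ! * d !)  ≡⟨ shuffle (n C suc i) (suc i) (i !) (d !) ⟩
  suc i * (n C suc i) * (i ! * d !)  ≡⟨ cong (_* (i ! * d !)) (choose-absorb i (suc d) e′) ⟩
  suc d * (n C i) * (i ! * d !)      ≡⟨ shuffle′ (suc d) (n C i) (i !) (d !) ⟩
  (n C i) * (i ! * suc d !)          ≡⟨ choose-! i (suc d) e′ ⟩
  n !                                ∎
  where
  open ≡-Reasoning
  e′ : i + suc d ≡ n
  e′ = trans (+-suc i d) e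
  shuffle : ∀ a b c d → a * (b * c * d) ≡ b * a * (c * d)
  shuffle = solve-∀
  shuffle′ : ∀ a b c d → a * b * (c * d) ≡ b * (c * (a * d))
  shuffle′ = solve-∀

levelSum-downSum-0 : ∀ {n} (f : Subset n → ℕ) → levelSum 0 (λ A → downSum A f) ≡ 0
levelSum-downSum-0 {zero} f = refl
levelSum-downSum-0 {suc n} f = levelSum-downSum-0 (f ∘ (false ∷_))

levelSum-downSum : ∀ {n} i (f : Subset n → ℕ) →
  levelSum (suc i) (λ A → downSum A f) ≡ (n ∸ i) * levelSum i f
levelSum-downSum {zero} zero f = refl
levelSum-downSum {zero} (suc i) f = refl
levelSum-downSum {suc n} zero f
  rewrite levelSum-+ 0 (f ∘ (false ∷_)) (λ A → downSum A (f ∘ (true ∷_)))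
        | levelSum-downSum-0 (f ∘ (true ∷_))
        | levelSum-downSum 0 (f ∘ (false ∷_)) =
  cong (_+ n * levelSum 0 (f ∘ (false ∷_))) (+-identityʳ _)
levelSum-downSum {suc n} (suc i) f
  rewrite levelSum-+ (suc i) (f ∘ (false ∷_)) (λ A → downSum A (f ∘ (true ∷_)))
        | levelSum-downSum i (f ∘ (true ∷_))
        | levelSum-downSum (suc i) (f ∘ (false ∷_)) with i <? n
... | yes i<n rewrite +-∸-assoc 1 i<n =
  lemma (levelSum (suc i) (f ∘ (false ∷_))) (levelSum i (f ∘ (true ∷_))) (n ∸ suc i)
  where
  lemma : ∀ a b e → a + suc e * b + e * a ≡ suc e * (b + a)
  lemma = solve-∀
-- For i ≥ n truncation breaks n - i = 1 + (n - (i + 1)), but the sum affected by it runs over an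
-- empty level.
... | no i≮n rewrite levelSum-> (suc i) (f ∘ (false ∷_)) (s≤s (≮⇒≥ i≮n)) =
  lemma (n ∸ i) (levelSum i (f ∘ (true ∷_))) (n ∸ suc i)
  where
  lemma : ∀ d b e → d * b + e * 0 ≡ d * (b + 0)
  lemma = solve-∀

♯ : Bool → ℕ
♯ b = if b then 1 else 0

upSum-witness : ∀ {n} (A : Subset n) (𝓕 : Family n) → 1 ≤ upSum A (♯ ∘ 𝓕) →
  ∃ λ B → A ⋖ B × B ∈F 𝓕
upSum-witness (true ∷ A) 𝓕 h with upSum-witness A (𝓕 ∘ (true ∷_)) h
... | B , c , B∈ = true ∷ B , keep c , B∈
upSum-witness (false ∷ A) 𝓕 h with 𝓕 (true ∷ A) in eq
... | true = true ∷ A , add , eq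
... | false with upSum-witness A (𝓕 ∘ (false ∷_)) h
... | B , c , B∈ = false ∷ B , keep c , B∈

upSum-witness₂ : ∀ {n} (A : Subset n) (𝓕 : Family n) → 2 ≤ upSum A (♯ ∘ 𝓕) →
  ∃₂ λ B B′ → A ⋖ B × A ⋖ B′ × B ∈F 𝓕 × B′ ∈F 𝓕 × B ≢ B′
upSum-witness₂ (true ∷ A) 𝓕 h with upSum-witness₂ A (𝓕 ∘ (true ∷_)) h
... | B , B′ , c , c′ , B∈ , B′∈ , B≢B′ =
  true ∷ B , true ∷ B′ , keep c , keep c′ , B∈ , B′∈ , λ { refl → B≢B′ refl }
upSum-witness₂ (false ∷ A) 𝓕 h with 𝓕 (true ∷ A) in eq
... | true with upSum-witness A (𝓕 ∘ (false ∷_)) (s≤s⁻¹ h)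
... | B , c , B∈ = true ∷ A , false ∷ B , add , keep c , eq , B∈ , λ ()
upSum-witness₂ (false ∷ A) 𝓕 h | false with upSum-witness₂ A (𝓕 ∘ (false ∷_)) h
... | B , B′ , c , c′ , B∈ , B′∈ , B≢B′ =
  false ∷ B , false ∷ B′ , keep c , keep c′ , B∈ , B′∈ , λ { refl → B≢B′ refl }

downSum-witness : ∀ {n} (A : Subset n) (𝓕 : Family n) → 1 ≤ downSum A (♯ ∘ 𝓕) →
  ∃ λ B → B ⋖ A × B ∈F 𝓕
downSum-witness (false ∷ A) 𝓕 h with downSum-witness A (𝓕 ∘ (false ∷_)) h
... | B , c , B∈ = false ∷ B , keep c , B∈
downSum-witness (true ∷ A) 𝓕 h with 𝓕 (false ∷ A) in eq
... | true = false ∷ A , add , eq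
... | false with downSum-witness A (𝓕 ∘ (true ∷_)) h
... | B , c , B∈ = true ∷ B , keep c , B∈

downSum-witness₂ : ∀ {n} (A : Subset n) (𝓕 : Family n) → 2 ≤ downSum A (♯ ∘ 𝓕) →
  ∃₂ λ B B′ → B ⋖ A × B′ ⋖ A × B ∈F 𝓕 × B′ ∈F 𝓕 × B ≢ B′
downSum-witness₂ (false ∷ A) 𝓕 h with downSum-witness₂ A (𝓕 ∘ (false ∷_)) h
... | B , B′ , c , c′ , B∈ , B′∈ , B≢B′ =
  false ∷ B , false ∷ B′ , keep c , keep c′ , B∈ , B′∈ , λ { refl → B≢B′ refl }
downSum-witness₂ (true ∷ A) 𝓕 h with 𝓕 (false ∷ A) in eq
... | true with downSum-witness A (𝓕 ∘ (true ∷_)) (s≤s⁻¹ h)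
... | B , c , B∈ = false ∷ A , true ∷ B , add , keep c , eq , B∈ , λ ()
downSum-witness₂ (true ∷ A) 𝓕 h | false with downSum-witness₂ A (𝓕 ∘ (true ∷_)) h
... | B , B′ , c , c′ , B∈ , B′∈ , B≢B′ =
  true ∷ B , true ∷ B′ , keep c , keep c′ , B∈ , B′∈ , λ { refl → B≢B′ refl }

-- Window inequalities

-- Saturated chains inside `𝓕`. They grow at the top because the averaging below extends a chain
-- upwards, one cover at a time.
data Path {n} (𝓕 : Family n) (A : Subset n) : ℕ → Subset n → Set where
  single : A ∈F 𝓕 → Path 𝓕 A 0 A
  snoc  : ∀ {r B T} → Path 𝓕 A r B → B ⋖ T → T ∈F 𝓕 → Path 𝓕 A (suc r) T

-- The sets of a path are indexed from its top end downwards.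
infixl 30 _‼_
_‼_ : ∀ {n} {𝓕 : Family n} {A r T} → Path 𝓕 A r T → ℕ → Subset n
_‼_ {A = A} (single _) i = A
_‼_ {T = T} (snoc p _ _) zero = T
snoc p _ _ ‼ suc i = p ‼ i

module _ {n : ℕ} {𝓕 : Family n} {A : Subset n} where

  ‼-top : ∀ {r T} (p : Path 𝓕 A r T) → p ‼ 0 ≡ T
  ‼-top (single _) = refl
  ‼-top (snoc _ _ _) = refl

  ‼-bottom : ∀ {r T} (p : Path 𝓕 A r T) → p ‼ r ≡ A
  ‼-bottom (single _) = refl
  ‼-bottom (snoc p _ _) = ‼-bottom p

  ‼-∈ : ∀ {r T} (p : Path 𝓕 A r T) i → p ‼ i ∈F 𝓕
  ‼-∈ (single A∈) i = A∈
  ‼-∈ (snoc p _ T∈) zero = T∈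
  ‼-∈ (snoc p _ _) (suc i) = ‼-∈ p i

  ‼-⋖ : ∀ {r T} (p : Path 𝓕 A r T) {i} → i < r → p ‼ suc i ⋖ p ‼ i
  ‼-⋖ (snoc p c _) {zero} _ = subst (_⋖ _) (sym (‼-top p)) c
  ‼-⋖ (snoc p _ _) {suc i} (s≤s i<r) = ‼-⋖ p i<r

module _ {n : ℕ} {𝓕 : Family n} (r : ℕ) {F₁ F₂ : Subset n} (G : ℕ → Subset n) where

  card≢ : ∀ {A B : Subset n} → ∣ A ∣ ≢ ∣ B ∣ → A ≢ B
  card≢ ≢ refl = ≢ refl

  -- Each cover adds one element, so the cardinalities determine the position in the configuration,
  -- and all distinctness conditions except F₁ ≢ F₂ follow from them.
  containsY : F₁ ∈F 𝓕 → F₂ ∈F 𝓕 → F₁ ≢ F₂ → (∀ i → G i ∈F 𝓕) →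
    (∀ i → i ≤ r → G i ⋖ G (suc i)) → G (suc r) ⋖ F₁ → G (suc r) ⋖ F₂ →
    ContainsY (3 + r) 𝓕
  containsY F₁∈ F₂∈ F₁≢F₂ G∈ G⋖ ⋖F₁ ⋖F₂ =
    F₁ , F₂ , G , F₁∈ , F₂∈ , (λ i _ → G∈ i) , F₁≢F₂
    , (λ i i< → card≢ (<⇒≢ (below ⋖F₁ i<)) , card≢ (<⇒≢ (below ⋖F₂ i<)))
    , (λ i j i< j< i≢j → card≢ λ e → i≢j (+-cancelˡ-≡ ∣ G 0 ∣ i j
        (trans (sym (card i (s≤s⁻¹ i<))) (trans e (card j (s≤s⁻¹ j<))))))
    , (λ i i< → ⋖⇒⊂ (G⋖ i (s≤s⁻¹ (s≤s⁻¹ i<))))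
    , ⋖⇒⊂ ⋖F₁ , ⋖⇒⊂ ⋖F₂
    , trans (⋖⇒card ⋖F₁) (sym (⋖⇒card ⋖F₂))
    , λ i i< → trans (trans (cong (_+ (2 + r ∸ i)) (card i (s≤s⁻¹ i<)))
                 (trans (+-assoc ∣ G 0 ∣ i _) (cong (∣ G 0 ∣ +_) (m+[n∸m]≡n (<⇒≤ i<)))))
               (sym (cardF ⋖F₁))
    where
    card : ∀ i → i ≤ suc r → ∣ G i ∣ ≡ ∣ G 0 ∣ + i
    card zero _ = sym (+-identityʳ _)
    card (suc i) (s≤s i≤r) = trans (⋖⇒card (G⋖ i i≤r))
      (trans (cong suc (card i (m≤n⇒m≤1+n i≤r))) (sym (+-suc _ i)))
    cardF : ∀ {F} → G (suc r) ⋖ F → ∣ F ∣ ≡ ∣ G 0 ∣ + (2 + r)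
    cardF c = trans (⋖⇒card c) (trans (cong suc (card (suc r) ≤-refl)) (sym (+-suc _ (suc r))))
    below : ∀ {F i} → G (suc r) ⋖ F → i < 2 + r → ∣ G i ∣ < ∣ F ∣
    below {F} {i} c i< = subst₂ _<_ (sym (card i (s≤s⁻¹ i<))) (sym (cardF c)) (+-monoʳ-< ∣ G 0 ∣ i<)

  containsY' : F₁ ∈F 𝓕 → F₂ ∈F 𝓕 → F₁ ≢ F₂ → (∀ i → G i ∈F 𝓕) →
    (∀ i → i ≤ r → G (suc i) ⋖ G i) → F₁ ⋖ G (suc r) → F₂ ⋖ G (suc r) →
    ContainsY' (3 + r) 𝓕
  containsY' F₁∈ F₂∈ F₁≢F₂ G∈ G⋖ F₁⋖ F₂⋖ =
    F₁ , F₂ , G , F₁∈ , F₂∈ , (λ i _ → G∈ i) , F₁≢F₂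
    , (λ i i< → card≢ (>⇒≢ (above F₁⋖ i<)) , card≢ (>⇒≢ (above F₂⋖ i<)))
    , (λ i j i< j< i≢j → card≢ λ e → i≢j (+-cancelˡ-≡ ∣ G i ∣ i j
        (trans (card i (s≤s⁻¹ i<)) (trans (sym (card j (s≤s⁻¹ j<))) (cong (_+ j) (sym e))))))
    , (λ i i< → ⋖⇒⊂ (G⋖ i (s≤s⁻¹ (s≤s⁻¹ i<))))
    , ⋖⇒⊂ F₁⋖ , ⋖⇒⊂ F₂⋖
    , suc-injective (trans (sym (⋖⇒card F₁⋖)) (⋖⇒card F₂⋖))
    , λ i i< → +-cancelʳ-≡ i _ _ (trans (card i (s≤s⁻¹ i<)) (trans (sym (cardF F₁⋖))
        (trans (cong (∣ F₁ ∣ +_) (sym (m∸n+n≡m (<⇒≤ i<)))) (sym (+-assoc ∣ F₁ ∣ _ i)))))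
    where
    card : ∀ i → i ≤ suc r → ∣ G i ∣ + i ≡ ∣ G 0 ∣
    card zero _ = +-identityʳ _
    card (suc i) (s≤s i≤r) = trans (+-suc _ i)
      (trans (cong (_+ i) (sym (⋖⇒card (G⋖ i i≤r)))) (card i (m≤n⇒m≤1+n i≤r)))
    cardF : ∀ {F} → F ⋖ G (suc r) → ∣ F ∣ + (2 + r) ≡ ∣ G 0 ∣
    cardF c = trans (+-suc _ (suc r)) (trans (cong (_+ suc r) (sym (⋖⇒card c))) (card (suc r) ≤-refl))
    above : ∀ {F i} → F ⋖ G (suc r) → i < 2 + r → ∣ F ∣ < ∣ G i ∣
    above {F} {i} c i< = +-cancelʳ-< i _ _ (<-≤-trans (+-monoʳ-< ∣ F ∣ i<)
      (≤-reflexive (trans (cardF c) (sym (card i (s≤s⁻¹ i<))))))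

module _ {n : ℕ} {𝓕 : Family n} {r : ℕ} {A T : Subset n} (p : Path 𝓕 A r T) where

  fork-above : ∀ {D F₁ F₂} → D ⋖ A → D ∈F 𝓕 → T ⋖ F₁ → T ⋖ F₂ →
    F₁ ∈F 𝓕 → F₂ ∈F 𝓕 → F₁ ≢ F₂ → ContainsY (3 + r) 𝓕
  fork-above {D} D⋖A D∈ T⋖F₁ T⋖F₂ F₁∈ F₂∈ F₁≢F₂ =
    containsY r G F₁∈ F₂∈ F₁≢F₂ G∈ G⋖ (subst (_⋖ _) top T⋖F₁) (subst (_⋖ _) top T⋖F₂)
    where
    G : ℕ → Subset n
    G zero = D
    -- Paths are indexed from the top, so the order is reversed here. Beyond the chain truncation
    -- repeats its top, which keeps every `G i` in the family.
    G (suc i) = p ‼ (r ∸ i)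
    top : T ≡ p ‼ (r ∸ r)
    top = trans (sym (‼-top p)) (cong (p ‼_) (sym (n∸n≡0 r)))
    G∈ : ∀ i → G i ∈F 𝓕
    G∈ zero = D∈
    G∈ (suc i) = ‼-∈ p (r ∸ i)
    G⋖ : ∀ i → i ≤ r → G i ⋖ G (suc i)
    G⋖ zero _ = subst (D ⋖_) (sym (‼-bottom p)) D⋖A
    G⋖ (suc i) i<r = subst (λ j → p ‼ j ⋖ p ‼ (r ∸ suc i)) (sym (+-∸-assoc 1 i<r))
      (‼-⋖ p (∸-monoʳ-< {o = 0} z<s i<r))

  fork-below : ∀ {D F₁ F₂} → T ⋖ D → D ∈F 𝓕 → F₁ ⋖ A → F₂ ⋖ A →
    F₁ ∈F 𝓕 → F₂ ∈F 𝓕 → F₁ ≢ F₂ → ContainsY' (3 + r) 𝓕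
  fork-below {D} T⋖D D∈ F₁⋖A F₂⋖A F₁∈ F₂∈ F₁≢F₂ =
    containsY' r G F₁∈ F₂∈ F₁≢F₂ G∈ G⋖ (subst (_ ⋖_) (sym (‼-bottom p)) F₁⋖A)
      (subst (_ ⋖_) (sym (‼-bottom p)) F₂⋖A)
    where
    G : ℕ → Subset n
    G zero = D
    G (suc i) = p ‼ i
    G∈ : ∀ i → G i ∈F 𝓕
    G∈ zero = D∈
    G∈ (suc i) = ‼-∈ p i
    G⋖ : ∀ i → i ≤ r → G (suc i) ⋖ G i
    G⋖ zero _ = subst (_⋖ D) (sym (‼-top p)) T⋖D
    G⋖ (suc i) i<r = ‼-⋖ p i<r

-- completions q r counts the saturated chains of length r going up from a set
-- whose complement has r + q elements.
completions : ℕ → ℕ → ℕ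
completions q zero = 1
completions q (suc r) = suc (r + q) * completions q r

completions-! : ∀ q r → completions q r * q ! ≡ (r + q) !
completions-! q zero = +-identityʳ _
completions-! q (suc r) = trans (*-assoc (suc (r + q)) (completions q r) _)
  (cong (suc (r + q) *_) (completions-! q r))

miss : ∀ {n} → Family n → Subset n → ℕ
miss 𝓕 A = ♯ (not (𝓕 A))

♯+miss : ∀ {n} (𝓕 : Family n) A → ♯ (𝓕 A) + miss 𝓕 A ≡ 1
♯+miss 𝓕 A with 𝓕 A
... | true = refl
... | false = refl

upSum-♯+miss : ∀ {n} (𝓕 : Family n) (A : Subset n) {q} → ∣ A ∣ + q ≡ n →
  upSum A (♯ ∘ 𝓕) + upSum A (miss 𝓕) ≡ q
upSum-♯+miss 𝓕 A {q} e = trans (sym (upSum-+ A (♯ ∘ 𝓕) (miss 𝓕)))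
  (trans (≤-antisym (upSum-mono A λ B _ → ≤-reflexive (♯+miss 𝓕 B))
                    (upSum-mono A λ B _ → ≤-reflexive (sym (♯+miss 𝓕 B))))
  (trans (upSum-const′ A 1 e) (*-identityʳ q)))

downSum-♯+miss : ∀ {n} (𝓕 : Family n) (A : Subset n) →
  downSum A (♯ ∘ 𝓕) + downSum A (miss 𝓕) ≡ ∣ A ∣
downSum-♯+miss 𝓕 A = trans (sym (downSum-+ A (♯ ∘ 𝓕) (miss 𝓕)))
  (trans (downSum-cong A (♯+miss 𝓕)) (trans (downSum-const A 1) (*-identityʳ _)))

-- p and q are the numbers of lower covers of the bottom and of upper covers of the
-- top of the chain being extended; all terms carry the common denominator p q.
missWeight : ∀ {n} → Family n → ℕ → ℕ → ℕ → Subset n → ℕ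
missWeight 𝓕 p q zero A = p * upSum A (miss 𝓕)
missWeight 𝓕 p q (suc r) A =
  upSum A λ B → p * q * completions q r * miss 𝓕 B + missWeight 𝓕 p q r B

-- The number δ is the boundary loss: δ = 0 is admissible when p, q ≥ 2, and δ = 1 when p = 1 or q =
-- 1.
module _ {n r₀ : ℕ} {𝓕 : Family n} (free : Free (3 + r₀) 𝓕) (p q δ : ℕ) (p+q≤ : p + q ≤ p * q + δ)
  {A : Subset n} (∣A∣≡p : ∣ A ∣ ≡ p) where

  private
    u : ℕ
    u = downSum A (♯ ∘ 𝓕)

    u≤p : u ≤ p
    u≤p = ≤-trans (m≤m+n u _) (≤-reflexive (trans (downSum-♯+miss 𝓕 A) ∣A∣≡p))

  -- Let v be the number of upper covers of `T` in the family. Since q - v of them are missing, this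
  -- is u/p + v/q ≤ 1 + δ/(pq). It is clear for u = 0 or v = 0, the hypothesis on p + q is exactly
  -- the case u = v = 1, and every other pair produces a fork above or below the chain.
  few-covers : ∀ {T} → Path 𝓕 A r₀ T → ∣ T ∣ + q ≡ n →
    u * q ≤ p * upSum T (miss 𝓕) + δ
  few-covers {T} π e = go u v refl refl
    where
    v = upSum T (♯ ∘ 𝓕)
    w = upSum T (miss 𝓕)
    v+w≡q : v + w ≡ q
    v+w≡q = upSum-♯+miss 𝓕 T e
    go : ∀ u′ v′ → u ≡ u′ → v ≡ v′ → u′ * q ≤ p * w + δ
    go zero _ _ _ = z≤n
    go u′ zero eu ev = ≤-trans (*-mono-≤ (≤-trans (≤-reflexive (sym eu)) u≤p)
      (≤-reflexive (trans (sym v+w≡q) (cong (_+ w) ev)))) (m≤m+n _ δ)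
    go (suc zero) (suc zero) eu ev = +-cancelˡ-≤ p _ _ (≤-trans (≤-reflexive (cong (p +_) (+-identityʳ q)))
      (≤-trans p+q≤ (≤-reflexive (trans (cong (λ x → p * x + δ) (trans (sym v+w≡q) (cong (_+ w) ev)))
        (lemma p w δ)))))
      where
      lemma : ∀ p w δ → p * suc w + δ ≡ p + (p * w + δ)
      lemma = solve-∀
    go (suc u′) (suc (suc v′)) eu ev
      with downSum-witness A 𝓕 (≤-trans (s≤s z≤n) (≤-reflexive (sym eu)))
         | upSum-witness₂ T 𝓕 (≤-trans (s≤s (s≤s z≤n)) (≤-reflexive (sym ev)))
    ... | D , D⋖A , D∈ | F₁ , F₂ , c₁ , c₂ , F₁∈ , F₂∈ , F₁≢F₂ =
      ⊥-elim (proj₁ free (fork-above π D⋖A D∈ c₁ c₂ F₁∈ F₂∈ F₁≢F₂))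
    go (suc (suc u′)) (suc v′) eu ev
      with downSum-witness₂ A 𝓕 (≤-trans (s≤s (s≤s z≤n)) (≤-reflexive (sym eu)))
         | upSum-witness T 𝓕 (≤-trans (s≤s z≤n) (≤-reflexive (sym ev)))
    ... | F₁ , F₂ , c₁ , c₂ , F₁∈ , F₂∈ , F₁≢F₂ | D , T⋖D , D∈ =
      ⊥-elim (proj₂ free (fork-below π T⋖D D∈ c₁ c₂ F₁∈ F₂∈ F₁≢F₂))

  -- Sums `few-covers` over all continuations of the chain by r more sets. A continuation that
  -- leaves the family at `B` needs no further argument: because u ≤ p, the term of `B` alone pays
  -- for everything above it.
  missWeight-≥ : ∀ r s {T} → r + s ≡ r₀ → Path 𝓕 A s T → ∣ T ∣ + (r + q) ≡ n →
    u * q * completions q r ≤ missWeight 𝓕 p q r T + δ * completions q r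
  missWeight-≥ zero s {T} refl π e =
    ≤-trans (≤-reflexive (*-identityʳ _)) (≤-trans (few-covers π e)
      (≤-reflexive (cong (p * upSum T (miss 𝓕) +_) (sym (*-identityʳ δ)))))
  missWeight-≥ (suc r) s {T} es π e = begin
    u * q * (suc (r + q) * c)     ≡⟨ swap (u * q) (suc (r + q)) c ⟩
    suc (r + q) * (u * q * c)     ≡⟨ sym (upSum-const′ T (u * q * c) e) ⟩
    upSum T (λ _ → u * q * c)     ≤⟨ upSum-mono T step ⟩
    upSum T (λ B → p * q * c * miss 𝓕 B + missWeight 𝓕 p q r B + δ * c)
      ≡⟨ upSum-+ T _ (λ _ → δ * c) ⟩
    missWeight 𝓕 p q (suc r) T + upSum T (λ _ → δ * c)
      ≡⟨ cong (missWeight 𝓕 p q (suc r) T +_) (trans (upSum-const′ T (δ * c) e) (swap (suc (r + q)) δ c)) ⟩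
    missWeight 𝓕 p q (suc r) T + δ * (suc (r + q) * c) ∎
    where
    open ≤-Reasoning
    c = completions q r
    swap : ∀ a b c → a * (b * c) ≡ b * (a * c)
    swap = solve-∀
    step : ∀ B → T ⋖ B → u * q * c ≤ p * q * c * miss 𝓕 B + missWeight 𝓕 p q r B + δ * c
    step B T⋖B with 𝓕 B in B∈
    ... | true = ≤-trans
      (missWeight-≥ r (suc s) (trans (+-suc r s) es) (snoc π T⋖B B∈)
        (trans (cong (_+ (r + q)) (⋖⇒card T⋖B)) (trans (sym (+-suc ∣ T ∣ _)) e)))
      (+-monoˡ-≤ (δ * c) (m≤n+m _ (p * q * c * 0)))
    ... | false = ≤-trans (*-monoˡ-≤ c (*-monoˡ-≤ q u≤p))
      (≤-trans (≤-reflexive (sym (*-identityʳ (p * q * c)))) (≤-trans (m≤m+n _ _) (m≤m+n _ _)))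

  -- If `A` is missing, its own term suffices. Otherwise u is p minus the number of missing lower
  -- covers, which brings the level below `A` into the estimate.
  local-inequality : p + (r₀ + q) ≡ n →
    p * q * completions q r₀ ≤
      p * q * completions q r₀ * miss 𝓕 A + q * completions q r₀ * downSum A (miss 𝓕)
      + missWeight 𝓕 p q r₀ A + δ * completions q r₀
  local-inequality e with 𝓕 A in A∈
  ... | false = ≤-trans (≤-reflexive (sym (*-identityʳ _)))
    (≤-trans (m≤m+n _ _) (≤-trans (m≤m+n _ _) (m≤m+n _ _)))
  ... | true = begin
    p * q * c
      ≡⟨ cong (λ x → x * q * c) (sym (trans (downSum-♯+miss 𝓕 A) ∣A∣≡p)) ⟩
    (u + d) * q * c
      ≡⟨ expand u d q c ⟩
    q * c * d + u * q * c
      ≤⟨ +-monoʳ-≤ (q * c * d) (missWeight-≥ r₀ 0 (+-identityʳ r₀) (single A∈) (trans (cong (_+ (r₀ + q)) ∣A∣≡p) e)) ⟩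
    q * c * d + (missWeight 𝓕 p q r₀ A + δ * c)
      ≡⟨ collect (p * q * c) (q * c * d) _ _ ⟩
    p * q * c * 0 + q * c * d + missWeight 𝓕 p q r₀ A + δ * c ∎
    where
    open ≤-Reasoning
    c = completions q r₀
    d = downSum A (miss 𝓕)
    expand : ∀ u d q c → (u + d) * q * c ≡ q * c * d + u * q * c
    expand = solve-∀
    collect : ∀ x a b e → a + (b + e) ≡ x * 0 + a + b + e
    collect = solve-∀

levelWeight : ∀ {n} → Family n → ℕ → ℕ
levelWeight {n} 𝓕 i = levelSum i (miss 𝓕) * (i ! * (n ∸ i) !)

-- Summing over level j turns each `upSum` into a sum over level j + 1 with a factor j + 1, which
-- raises j! to (j + 1)!. The completions times (q + 1)! give the other factorial, so every missing
-- set ends up with the number of maximal chains through it.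
levelSum-missWeight : ∀ {n} (𝓕 : Family n) p q r j → j + (r + suc q) ≡ n →
  levelSum j (missWeight 𝓕 p (suc q) r) * (j ! * suc q !)
    ≡ p * suc q * Σ< (suc r) (λ i → levelWeight 𝓕 (suc j + i))
levelSum-missWeight {n} 𝓕 p q zero j e = begin
  levelSum j (λ A → p * upSum A (miss 𝓕)) * (j ! * (suc q * q !))
    ≡⟨ cong (_* (j ! * (suc q * q !))) (trans (levelSum-* j p (λ A → upSum A (miss 𝓕))) (cong (p *_) (levelSum-upSum j (miss 𝓕)))) ⟩
  p * (suc j * M) * (j ! * (suc q * q !))
    ≡⟨ shuffle p j q M (j !) (q !) ⟩
  p * suc q * (M * (suc j ! * q !) + 0)
    ≡⟨ cong₂ (λ i x → p * suc q * (levelSum i (miss 𝓕) * (i ! * x !) + 0))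
         (sym (+-identityʳ (suc j)))
         (sym (trans (cong₂ _∸_ (trans (sym e) (+-suc j q)) (+-identityʳ (suc j))) (m+n∸m≡n j q))) ⟩
  p * suc q * (levelWeight 𝓕 (suc j + 0) + 0) ∎
  where
  open ≡-Reasoning
  M = levelSum (suc j) (miss 𝓕)
  shuffle : ∀ p j q M a b → p * (suc j * M) * (a * (suc q * b)) ≡ p * suc q * (M * (suc j * a * b) + 0)
  shuffle = solve-∀
levelSum-missWeight {n} 𝓕 p q (suc r) j e = begin
  levelSum j (λ A → upSum A (λ B → p * suc q * c * miss 𝓕 B + missWeight 𝓕 p (suc q) r B)) * (j ! * suc q !)
    ≡⟨ cong (_* (j ! * suc q !)) (trans (levelSum-upSum j (λ B → p * suc q * c * miss 𝓕 B + missWeight 𝓕 p (suc q) r B)) (cong (suc j *_)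
         (trans (levelSum-+ (suc j) (λ B → p * suc q * c * miss 𝓕 B) (missWeight 𝓕 p (suc q) r)) (cong (_+ W) (levelSum-* (suc j) (p * suc q * c) (miss 𝓕)))))) ⟩
  suc j * (p * suc q * c * M + W) * (j ! * suc q !)
    ≡⟨ shuffle (p * suc q) (suc j) c M W (j !) (suc q !) ⟩
  p * suc q * (M * (suc j ! * (c * suc q !))) + W * (suc j ! * suc q !)
    ≡⟨ cong₂ (λ x y → p * suc q * (M * (suc j ! * x)) + y)
         (trans (completions-! (suc q) r) (cong _! (sym (trans (cong (_∸ suc j) (sym e′)) (m+n∸m≡n (suc j) _)))))
         (levelSum-missWeight 𝓕 p q r (suc j) e′) ⟩
  p * suc q * levelWeight 𝓕 (suc j) + p * suc q * Σ< (suc r) (λ i → levelWeight 𝓕 (suc (suc j) + i))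
    ≡⟨ sym (*-distribˡ-+ (p * suc q) _ _) ⟩
  p * suc q * (levelWeight 𝓕 (suc j) + Σ< (suc r) (λ i → levelWeight 𝓕 (suc (suc j) + i)))
    ≡⟨ cong (p * suc q *_) (cong₂ _+_ (cong (levelWeight 𝓕) (sym (+-identityʳ (suc j))))
         (Σ<-cong (suc r) λ i _ → cong (levelWeight 𝓕) (sym (+-suc (suc j) i)))) ⟩
  p * suc q * Σ< (suc (suc r)) (λ i → levelWeight 𝓕 (suc j + i)) ∎
  where
  open ≡-Reasoning
  c = completions (suc q) r
  M = levelSum (suc j) (miss 𝓕)
  W = levelSum (suc j) (missWeight 𝓕 p (suc q) r)
  e′ : suc j + (r + suc q) ≡ n
  e′ = trans (sym (+-suc j _)) e
  shuffle : ∀ z j c M W a b → j * (z * c * M + W) * (a * b) ≡ z * (M * (j * a * (c * b))) + W * (j * a * b)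
  shuffle = solve-∀

-- The sum of `local-inequality` over level a + 1, scaled by factorials. Level a enters through the
-- lower covers, level a + 1 through `A` itself, and the levels above through `missWeight`.
window-inequality : ∀ {n r} {𝓕 : Family n} → Free (3 + r) 𝓕 → ∀ a q δ →
  suc a + suc q ≤ suc a * suc q + δ → suc a + (r + suc q) ≡ n →
  suc a * suc q * n ! ≤ suc a * suc q * Σ< (3 + r) (λ i → levelWeight 𝓕 (a + i)) + δ * n !
window-inequality {n} {r} {𝓕} free a q δ p+q≤ e = begin
  p * q′ * n !
    ≡⟨ cong (p * q′ *_) (sym nCp) ⟩
  p * q′ * ((n C p) * (p ! * (r + q′) !))
    ≡⟨ cong (λ x → p * q′ * ((n C p) * (p ! * x))) (sym (completions-! q′ r)) ⟩
  p * q′ * ((n C p) * (p ! * (c * q′ !)))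
    ≡⟨ shuffle₁ (p * q′) (n C p) (p !) c (q′ !) ⟩
  (n C p) * (p * q′ * c) * (p ! * q′ !)
    ≡⟨ cong (_* (p ! * q′ !)) (sym (levelSum-const n p (p * q′ * c))) ⟩
  levelSum {n} p (λ _ → p * q′ * c) * (p ! * q′ !)
    ≤⟨ *-monoˡ-≤ (p ! * q′ !) (levelSum-mono {n} p λ A ∣A∣≡p →
         local-inequality free p q′ δ p+q≤ {A} ∣A∣≡p e) ⟩
  levelSum p (λ A → p * q′ * c * miss 𝓕 A + q′ * c * downSum A (miss 𝓕) + missWeight 𝓕 p q′ r A + δ * c)
    * (p ! * q′ !)
    ≡⟨ cong (_* (p ! * q′ !)) split ⟩
  (p * q′ * c * M p + q′ * c * ((n ∸ a) * M a) + W + (n C p) * (δ * c)) * (p ! * q′ !)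
    ≡⟨ shuffle₂ p q′ c (M p) (M a) (n ∸ a) W (n C p) δ (a !) (p !) (q′ !) refl ⟩
  p * q′ * (M a * (a ! * ((n ∸ a) * (c * q′ !))) + M p * (p ! * (c * q′ !)))
    + W * (p ! * q′ !) + δ * ((n C p) * (p ! * (c * q′ !)))
    ≡⟨ cong₂ _+_ (cong₂ _+_ (cong (p * q′ *_) (cong₂ _+_ first second))
         (levelSum-missWeight 𝓕 p q r p e))
         (cong (δ *_) (trans (cong (λ x → (n C p) * (p ! * x)) (completions-! q′ r)) nCp)) ⟩
  p * q′ * (levelWeight 𝓕 (a + 0) + levelWeight 𝓕 (a + 1))
    + p * q′ * Σ< (suc r) (λ i → levelWeight 𝓕 (suc p + i)) + δ * n !
    ≡⟨ cong (_+ δ * n !) (trans (sym (*-distribˡ-+ (p * q′) (levelWeight 𝓕 (a + 0) + levelWeight 𝓕 (a + 1)) tail)) (cong (p * q′ *_)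
         (trans (+-assoc (levelWeight 𝓕 (a + 0)) (levelWeight 𝓕 (a + 1)) tail)
           (cong (λ x → levelWeight 𝓕 (a + 0) + (levelWeight 𝓕 (a + 1) + x))
             (Σ<-cong (suc r) λ i _ → cong (levelWeight 𝓕) (sym (shift a i))))))) ⟩
  p * q′ * Σ< (3 + r) (λ i → levelWeight 𝓕 (a + i)) + δ * n ! ∎
  where
  open ≤-Reasoning
  p = suc a
  q′ = suc q
  c = completions q′ r
  M = λ i → levelSum i (miss 𝓕)
  W = levelSum p (missWeight 𝓕 p q′ r)
  nCp : (n C p) * (p ! * (r + q′) !) ≡ n !
  nCp = choose-! p (r + q′) e
  tail = Σ< (suc r) (λ i → levelWeight 𝓕 (suc p + i))
  n∸p : n ∸ p ≡ r + q′
  n∸p = trans (cong (_∸ p) (sym e)) (m+n∸m≡n p _)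
  n∸a : n ∸ a ≡ suc (r + q′)
  n∸a = trans (cong (_∸ a) (trans (sym e) (sym (+-suc a _)))) (m+n∸m≡n a _)
  first : M a * (a ! * ((n ∸ a) * (c * q′ !))) ≡ levelWeight 𝓕 (a + 0)
  first = trans (cong₂ (λ x y → M a * (a ! * (x * y))) n∸a (completions-! q′ r))
    (trans (cong (λ x → M a * (a ! * x !)) (sym n∸a)) (cong (levelWeight 𝓕) (sym (+-identityʳ a))))
  second : M p * (p ! * (c * q′ !)) ≡ levelWeight 𝓕 (a + 1)
  second = trans (cong (λ x → M p * (p ! * x)) (trans (completions-! q′ r) (cong _! (sym n∸p))))
    (cong (levelWeight 𝓕) (+-comm 1 a))
  shift : ∀ a i → a + suc (suc i) ≡ suc (suc a) + i
  shift = solve-∀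
  shuffle₁ : ∀ z b f c g → z * (b * (f * (c * g))) ≡ b * (z * c) * (f * g)
  shuffle₁ = solve-∀
  split : levelSum p (λ A → p * q′ * c * miss 𝓕 A + q′ * c * downSum A (miss 𝓕) + missWeight 𝓕 p q′ r A + δ * c)
    ≡ p * q′ * c * M p + q′ * c * ((n ∸ a) * M a) + W + (n C p) * (δ * c)
  split = trans (levelSum-+ {n} p _ (λ _ → δ * c)) (cong₂ _+_
    (trans (levelSum-+ p _ (missWeight 𝓕 p q′ r)) (cong (_+ W)
      (trans (levelSum-+ p _ (λ A → q′ * c * downSum A (miss 𝓕))) (cong₂ _+_
        (levelSum-* p (p * q′ * c) (miss 𝓕))
        (trans (levelSum-* p (q′ * c) (λ A → downSum A (miss 𝓕)))
          (cong (q′ * c *_) (levelSum-downSum a (miss 𝓕))))))))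
    (levelSum-const n p (δ * c)))
  shuffle₂ : ∀ p q c b d h W e δ f pf g → pf ≡ p * f →
    (p * q * c * b + q * c * (h * d) + W + e * (δ * c)) * (pf * g)
    ≡ p * q * (d * (f * (h * (c * g))) + b * (pf * (c * g))) + W * (pf * g) + δ * (e * (pf * (c * g)))
  shuffle₂ p q c b d h W e δ f pf g refl = lemma p q c b d h W e δ f g
    where
    lemma : ∀ p q c b d h W e δ f g →
      (p * q * c * b + q * c * (h * d) + W + e * (δ * c)) * (p * f * g)
      ≡ p * q * (d * (f * (h * (c * g))) + b * (p * f * (c * g))) + W * (p * f * g) + δ * (e * (p * f * (c * g)))
    lemma = solve-∀

-- Binomial sums over residue classes

%-congʳ-+ : ∀ κ c {a b} → a % suc κ ≡ b % suc κ → (c + a) % suc κ ≡ (c + b) % suc κ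
%-congʳ-+ κ c {a} {b} e = trans (%-distribˡ-+ c a (suc κ))
  (trans (cong (λ x → (c % suc κ + x) % suc κ) e) (sym (%-distribˡ-+ c b (suc κ))))

-- Modulo κ + 1, adding `κ * c` is the same as subtracting c.
%-cancelˡ-+ : ∀ κ c {a b} → (c + a) % suc κ ≡ (c + b) % suc κ → a % suc κ ≡ b % suc κ
%-cancelˡ-+ κ c {a} {b} e = trans (sym (drop a)) (trans (%-congʳ-+ κ (κ * c) e) (drop b))
  where
  lemma : ∀ κ c a → κ * c + (c + a) ≡ a + c * suc κ
  lemma = solve-∀
  drop : ∀ a → (κ * c + (c + a)) % suc κ ≡ a % suc κ
  drop a = trans (cong (_% suc κ) (lemma κ c a)) ([m+kn]%n≡m%n a c (suc κ))

-- Moduli and window lengths are written κ + 1.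
ρ : ℕ → ℕ → ℕ → ℕ
ρ κ a b with (a % suc κ) ≟ (b % suc κ)
... | yes _ = 1
... | no _ = 0

ρ≡1 : ∀ κ {a b} → a % suc κ ≡ b % suc κ → ρ κ a b ≡ 1
ρ≡1 κ {a} {b} e with (a % suc κ) ≟ (b % suc κ)
... | yes _ = refl
... | no ≢ = contradiction e ≢

ρ≡0 : ∀ κ {a b} → a % suc κ ≢ b % suc κ → ρ κ a b ≡ 0
ρ≡0 κ {a} {b} ≢ with (a % suc κ) ≟ (b % suc κ)
... | yes e = contradiction e ≢
... | no _ = refl

ρ-⇔ : ∀ κ {a b c d} → (a % suc κ ≡ b % suc κ → c % suc κ ≡ d % suc κ) →
  (c % suc κ ≡ d % suc κ → a % suc κ ≡ b % suc κ) → ρ κ a b ≡ ρ κ c d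
ρ-⇔ κ {a} {b} f g with (a % suc κ) ≟ (b % suc κ)
... | yes e = sym (ρ≡1 κ (f e))
... | no ≢ = sym (ρ≡0 κ (≢ ∘ g))

ρ-+ˡ : ∀ κ c a b → ρ κ (c + a) (c + b) ≡ ρ κ a b
ρ-+ˡ κ c a b = ρ-⇔ κ (%-cancelˡ-+ κ c) (%-congʳ-+ κ c)

ρ-sym : ∀ κ a b → ρ κ a b ≡ ρ κ b a
ρ-sym κ a b = ρ-⇔ κ sym sym

ρ-congʳ : ∀ κ a {b c} → b % suc κ ≡ c % suc κ → ρ κ a b ≡ ρ κ a c
ρ-congʳ κ a e = ρ-⇔ κ (λ x → trans x e) (λ x → trans x (sym e))

ρ-period : ∀ κ a b → ρ κ a (b + suc κ) ≡ ρ κ a b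
ρ-period κ a b = ρ-congʳ κ a ([m+n]%n≡m%n b (suc κ))

ρ-< : ∀ κ {a b} → a < b → b ≤ κ → ρ κ a b ≡ 0
ρ-< κ {a} {b} a<b b≤κ = ρ≡0 κ λ e → <⇒≢ a<b (trans (sym (m<n⇒m%n≡m (m<n⇒m<1+n (<-≤-trans a<b b≤κ))))
  (trans e (m<n⇒m%n≡m (s≤s b≤κ))))

Σ<-pascal : ∀ n (w : ℕ → ℕ) → Σ< (2 + n) (λ i → w i * (suc n C i))
  ≡ Σ< (suc n) (λ i → w i * (n C i)) + Σ< (suc n) (λ i → w (suc i) * (n C i))
Σ<-pascal n w = begin
  w 0 * (suc n C 0) + Σ< (suc n) (λ i → w (suc i) * (suc n C suc i))
    ≡⟨ cong₂ _+_ (cong (w 0 *_) (trans (nC0≡1 (suc n)) (sym (nC0≡1 n))))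
         (Σ<-cong (suc n) λ i _ → trans (cong (w (suc i) *_) (sym (nCk+nC[k+1]≡[n+1]C[k+1] n i)))
           (*-distribˡ-+ (w (suc i)) (n C i) (n C suc i))) ⟩
  w 0 * (n C 0) + Σ< (suc n) (λ i → w (suc i) * (n C i) + w (suc i) * (n C suc i))
    ≡⟨ cong (w 0 * (n C 0) +_) (Σ<-+ (suc n) (λ i → w (suc i) * (n C i)) (λ i → w (suc i) * (n C suc i))) ⟩
  w 0 * (n C 0) + (B + Σ< (suc n) (λ i → w (suc i) * (n C suc i)))
    ≡⟨ shuffle (w 0 * (n C 0)) B _ ⟩
  Σ< (2 + n) (λ i → w i * (n C i)) + B
    ≡⟨ cong (_+ B) (trans (Σ<-snoc (suc n) (λ i → w i * (n C i)))
         (trans (cong (λ x → A + w (suc n) * x) (k>n⇒nCk≡0 {n} {suc n} ≤-refl))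
         (trans (cong (A +_) (*-zeroʳ (w (suc n)))) (+-identityʳ A)))) ⟩
  A + B ∎
  where
  open ≡-Reasoning
  A = Σ< (suc n) (λ i → w i * (n C i))
  B = Σ< (suc n) (λ i → w (suc i) * (n C i))
  shuffle : ∀ a b c → a + (b + c) ≡ a + c + b
  shuffle = solve-∀

-- cyclic κ n x is the sum of the binomials (n choose i) with i ≡ - x (mod κ + 1).
cyclic : ℕ → ℕ → ℕ → ℕ
cyclic κ zero x = ρ κ x 0
cyclic κ (suc n) x = cyclic κ n x + cyclic κ n (suc x)

cyclic-Σ : ∀ κ n x → cyclic κ n x ≡ Σ< (suc n) (λ i → ρ κ (x + i) 0 * (n C i))
cyclic-Σ κ zero x rewrite +-identityʳ x = lemma (ρ κ x 0)
  where
  lemma : ∀ a → a ≡ a * 1 + 0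
  lemma = solve-∀
cyclic-Σ κ (suc n) x = trans (cong₂ _+_ (cyclic-Σ κ n x) (trans (cyclic-Σ κ n (suc x))
    (Σ<-cong (suc n) λ i _ → cong (λ y → ρ κ y 0 * (n C i)) (sym (+-suc x i)))))
  (sym (Σ<-pascal n (λ i → ρ κ (x + i) 0)))

cyclic-period : ∀ κ n x → cyclic κ n (x + suc κ) ≡ cyclic κ n x
cyclic-period κ zero x = trans (ρ-sym κ _ 0) (trans (ρ-period κ 0 x) (ρ-sym κ 0 x))
cyclic-period κ (suc n) x = cong₂ _+_ (cyclic-period κ n x) (cyclic-period κ n (suc x))

-- Once β < α < β + k, the induction passes to the pairs (α, β + 1) and (α + 1, β), which
-- satisfy the same bounds.  The multiple c k of the period plays the role of 0, so that
-- everything stays within the naturals.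
cyclic-mono : ∀ κ n c α β → (c + c) * suc κ ≤ n + (α + β) → n + (α + β) ≤ (c + c) * suc κ + suc κ →
  β ≤ α → α ≤ β + suc κ → cyclic κ n α ≤ cyclic κ n β
cyclic-mono κ zero c α β lo hi β≤α α≤β+k with (α % suc κ) ≟ 0
... | no ≢ = z≤n
... | yes e = ≤-reflexive (sym (ρ≡1 κ {β} {0} (trans (cong (_% k) β≡ck) (m*n%n≡0 c k))))
  where
  k = suc κ
  q = α / k
  α≡qk : α ≡ q * k
  α≡qk = trans (m≡m%n+[m/n]*n α k) (cong (_+ q * k) e)
  -- As α is a multiple of k, either α ≤ c k or α ≥ (c + 1) k. In the first case β ≤ α and the lower
  -- bound on α + β force β = c k, in the second the upper bound and α ≤ β + k do.
  β≡ck : β ≡ c * k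
  β≡ck with q ≤? c
  ... | yes q≤c = ≤-antisym (≤-trans β≤α α≤ck)
    (+-cancelˡ-≤ (c * k) _ _ (≤-trans (≤-reflexive (sym (*-distribʳ-+ k c c)))
      (≤-trans lo (+-monoˡ-≤ β α≤ck))))
    where
    α≤ck : α ≤ c * k
    α≤ck = ≤-trans (≤-reflexive α≡qk) (*-monoˡ-≤ k q≤c)
  ... | no q≰c = ≤-antisym
    (+-cancelˡ-≤ (k + c * k) _ _ (≤-trans (+-monoˡ-≤ β ck+k≤α) (≤-trans hi (≤-reflexive (lemma c k)))))
    (+-cancelˡ-≤ k _ _ (≤-trans ck+k≤α (≤-trans α≤β+k (≤-reflexive (+-comm β k)))))
    where
    ck+k≤α : k + c * k ≤ α
    ck+k≤α = ≤-trans (*-monoˡ-≤ k (≰⇒> q≰c)) (≤-reflexive (sym α≡qk))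
    lemma : ∀ c k → (c + c) * k + k ≡ k + c * k + c * k
    lemma = solve-∀
cyclic-mono κ (suc n) c α β lo hi β≤α α≤β+k with m≤n⇒m<n∨m≡n β≤α | m≤n⇒m<n∨m≡n α≤β+k
... | inj₂ refl | _ = ≤-refl
... | inj₁ _ | inj₂ refl = ≤-reflexive (cyclic-period κ (suc n) β)
... | inj₁ β<α | inj₁ α<β+k = ≤-trans (+-mono-≤
    (cyclic-mono κ n c α (suc β) (subst ((c + c) * suc κ ≤_) (right n α β) lo) (subst (_≤ (c + c) * suc κ + suc κ) (right n α β) hi)
      β<α (m≤n⇒m≤1+n α≤β+k))
    (cyclic-mono κ n c (suc α) β (subst ((c + c) * suc κ ≤_) (sym (+-suc n _)) lo) (subst (_≤ (c + c) * suc κ + suc κ) (sym (+-suc n _)) hi)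
      (m≤n⇒m≤1+n β≤α) α<β+k))
  (≤-reflexive (+-comm (cyclic κ n (suc β)) _))
  where
  right : ∀ n α β → suc n + (α + β) ≡ n + (α + suc β)
  right = solve-∀

-- This is S(n, κ + 1, i), with the residue test written as a 0-1 factor.
classSum : ℕ → ℕ → ℕ → ℕ
classSum κ n i = Σ< (suc n) (λ l → ρ κ l i * (n C l))

classSum-cyclic : ∀ κ n {x i c} → x + i ≡ c * suc κ → classSum κ n i ≡ cyclic κ n x
classSum-cyclic κ n {x} {i} {c} e = trans (Σ<-cong (suc n) λ l _ → cong (_* (n C l))
    (trans (sym (ρ-+ˡ κ x l i)) (ρ-congʳ κ (x + l) {x + i} {0} (trans (cong (_% suc κ) e) (m*n%n≡0 c (suc κ))))))
  (sym (cyclic-Σ κ n x))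

-- The reflection i ↦ N - i turns class sums into values of `cyclic`. Here N = n k is a multiple of
-- the period and at least n, so nothing truncates, and the bounds on m + i become those of
-- `cyclic-mono` with c = n.
classSum-min : ∀ κ n {m i} → m ≤ i → i ≤ m + suc κ → m + i ≤ n → n ≤ m + i + suc κ →
  classSum κ n m ≤ classSum κ n i
classSum-min κ n {m} {i} m≤i i≤m+k m+i≤n n≤ = subst₂ _≤_
  (sym (classSum-cyclic κ n {c = n} α+m)) (sym (classSum-cyclic κ n {c = n} β+i))
  (cyclic-mono κ n n α β
    (+-cancelʳ-≤ (m + i) _ _ (≤-trans (+-monoʳ-≤ ((n + n) * k) m+i≤n) (≤-reflexive (sym balance))))
    (+-cancelʳ-≤ (m + i) _ _ (≤-trans (≤-reflexive balance) (≤-trans (+-monoʳ-≤ ((n + n) * k) n≤)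
      (≤-reflexive (shuffle₂ ((n + n) * k) (m + i) k)))))
    (∸-monoʳ-≤ N m≤i)
    (+-cancelʳ-≤ (m + i) _ _ (subst₂ _≤_ (trans (cong (_+ i) (sym α+m)) (+-assoc α m i))
      (trans (cong (_+ (m + k)) (sym β+i)) (shuffle₃ β i m k)) (+-monoʳ-≤ N i≤m+k))))
  where
  k = suc κ
  N = n * k
  n≤N : n ≤ N
  n≤N = m≤m*n n k
  α = N ∸ m
  β = N ∸ i
  α+m : α + m ≡ N
  α+m = m∸n+n≡m (≤-trans (m≤m+n m i) (≤-trans m+i≤n n≤N))
  β+i : β + i ≡ N
  β+i = m∸n+n≡m (≤-trans (m≤n+m i m) (≤-trans m+i≤n n≤N))
  shuffle₁ : ∀ n α β m i → n + (α + β) + (m + i) ≡ α + m + (β + i) + n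
  shuffle₁ = solve-∀
  shuffle₂ : ∀ a b k → a + (b + k) ≡ a + k + b
  shuffle₂ = solve-∀
  shuffle₃ : ∀ β i m k → β + i + (m + k) ≡ β + k + (m + i)
  shuffle₃ = solve-∀
  balance : n + (α + β) + (m + i) ≡ (n + n) * k + n
  balance = trans (shuffle₁ n α β m i) (cong (_+ n) (trans (cong₂ _+_ α+m β+i) (sym (*-distribʳ-+ k n n))))

-- With k = κ + 1 this is (n choose i - k) + (n choose i - 2k) + ..., the part of the residue class
-- of i strictly below i.
lowerSum : ℕ → ℕ → ℕ → ℕ
lowerSum κ n i = Σ< i (λ l → ρ κ l i * (n C l))

lowerSum-small : ∀ κ n {i} → i ≤ κ → lowerSum κ n i ≡ 0
lowerSum-small κ n i≤κ = Σ<-zero _ λ l l<i → cong (_* (n C l)) (ρ-< κ l<i i≤κ)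

lowerSum-step : ∀ κ n i → lowerSum κ n (i + suc κ) ≡ lowerSum κ n i + (n C i)
lowerSum-step κ n i = trans (Σ<-split i (suc κ) _) (cong₂ _+_
  (Σ<-cong i λ l _ → cong (_* (n C l)) (ρ-period κ l i))
  (trans (cong₂ _+_ first (Σ<-zero κ rest)) (+-identityʳ _)))
  where
  first : ρ κ (i + 0) (i + suc κ) * (n C (i + 0)) ≡ n C i
  first rewrite +-identityʳ i =
    trans (cong (_* (n C i)) (trans (ρ-period κ i i) (ρ≡1 κ {i} {i} refl))) (*-identityˡ _)
  rest : ∀ j → j < κ → ρ κ (i + suc j) (i + suc κ) * (n C (i + suc j)) ≡ 0
  rest j j<κ = cong (_* (n C (i + suc j))) (trans (ρ-+ˡ κ i (suc j) (suc κ))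
    (trans (ρ-period κ (suc j) 0) (trans (ρ-sym κ (suc j) 0) (ρ-< κ z<s j<κ))))

-- The part of the class above i becomes a lower sum at n - i under the symmetry l ↦ n - l of the
-- binomials.
classSum-split : ∀ κ {n} i d → i + d ≡ n →
  classSum κ n i ≡ lowerSum κ n i + (n C i) + lowerSum κ n d
classSum-split κ {n} i d e = begin
  Σ< (suc n) f                      ≡⟨ cong (λ x → Σ< x f) (trans (cong suc (sym e)) (sym (+-suc i d))) ⟩
  Σ< (i + suc d) f                  ≡⟨ Σ<-split i (suc d) f ⟩
  Σ< i f + (f (i + 0) + Σ< d (λ j → f (i + suc j)))
    ≡⟨ cong₂ (λ x y → Σ< i f + (x + y)) middle (trans (Σ<-reverse d (λ j → f (i + j))) (Σ<-cong d upper)) ⟩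
  Σ< i f + ((n C i) + lowerSum κ n d) ≡⟨ sym (+-assoc (Σ< i f) _ _) ⟩
  Σ< i f + (n C i) + lowerSum κ n d ∎
  where
  open ≡-Reasoning
  f = λ l → ρ κ l i * (n C l)
  middle : f (i + 0) ≡ n C i
  middle rewrite +-identityʳ i = trans (cong (_* (n C i)) (ρ≡1 κ {i} {i} refl)) (*-identityˡ _)
  upper : ∀ l → l < d → f (i + (d ∸ l)) ≡ ρ κ l d * (n C l)
  upper l l<d = cong₂ _*_
    (trans (cong (ρ κ (i + (d ∸ l))) (sym (+-identityʳ i))) (trans (ρ-+ˡ κ i (d ∸ l) 0)
      (trans (sym (ρ-+ˡ κ l (d ∸ l) 0)) (trans (cong₂ (ρ κ) (m+[n∸m]≡n (<⇒≤ l<d)) (+-identityʳ l)) (ρ-sym κ d l)))))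
    (trans (cong (n C_) (trans (sym (+-∸-assoc i (<⇒≤ l<d))) (cong (_∸ l) e)))
      (sym (nCk≡nC[n∸k] (≤-trans (<⇒≤ l<d) (≤-trans (m≤n+m d i) (≤-reflexive e))))))

choose-mono : ∀ {n} l → suc (l + l) ≤ n → n C l ≤ n C suc l
choose-mono {n} l h = *-cancelˡ-≤ (suc l) (≤-trans
  (*-monoˡ-≤ (n C l) (m+n≤o⇒m≤o∸n (suc l) h))
  (≤-reflexive (sym (choose-absorb l (n ∸ l) (m+[n∸m]≡n (≤-trans (m≤m+n l l) (≤-trans (n≤1+n _) h)))))))

-- Linear programming duality

inWindow : ℕ → ℕ → ℕ → ℕ
inWindow κ a i with a ≤? i | i ≤? a + κ
... | yes _ | yes _ = 1
... | yes _ | no _ = 0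
... | no _  | _ = 0

inWindow≤1 : ∀ κ a i → inWindow κ a i ≤ 1
inWindow≤1 κ a i with a ≤? i | i ≤? a + κ
... | yes _ | yes _ = ≤-refl
... | yes _ | no _ = z≤n
... | no _  | _ = z≤n

inWindow-∈ : ∀ κ {a i} → a ≤ i → i ≤ a + κ → inWindow κ a i ≡ 1
inWindow-∈ κ {a} {i} a≤i i≤ with a ≤? i | i ≤? a + κ
... | yes _ | yes _ = refl
... | yes _ | no ≰ = contradiction i≤ ≰
... | no ≰  | _ = contradiction a≤i ≰

inWindow-< : ∀ κ {a i} → i < a → inWindow κ a i ≡ 0
inWindow-< κ {a} {i} i<a with a ≤? i | i ≤? a + κ
... | yes a≤i | _ = contradiction a≤i (<⇒≱ i<a)
... | no _ | _ = refl

inWindow-> : ∀ κ {a i} → a + κ < i → inWindow κ a i ≡ 0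
inWindow-> κ {a} {i} < with a ≤? i | i ≤? a + κ
... | yes _ | yes i≤ = contradiction i≤ (<⇒≱ <)
... | yes _ | no _ = refl
... | no _  | _ = refl

Σ-inWindow : ∀ κ n a (x : ℕ → ℕ) → a + κ ≤ n →
  Σ< (suc κ) (λ j → x (a + j)) ≤ Σ< (suc n) (λ i → inWindow κ a i * x i)
Σ-inWindow κ n a x a+κ≤n = begin
  Σ< (suc κ) (λ j → x (a + j))
    ≤⟨ Σ<-mono (suc κ) (λ j j<k → ≤-reflexive (sym (trans
         (cong (_* x (a + j)) (inWindow-∈ κ (m≤m+n a j) (+-monoʳ-≤ a (s≤s⁻¹ j<k)))) (*-identityˡ _)))) ⟩
  Σ< (suc κ) (λ j → f (a + j))                       ≤⟨ m≤m+n _ _ ⟩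
  Σ< (suc κ) (λ j → f (a + j)) + Σ< c (λ j → f (a + (suc κ + j)))
    ≡⟨ sym (Σ<-split (suc κ) c (λ j → f (a + j))) ⟩
  Σ< (suc κ + c) (λ j → f (a + j))                   ≤⟨ m≤n+m _ (Σ< a f) ⟩
  Σ< a f + Σ< (suc κ + c) (λ j → f (a + j))          ≡⟨ sym (Σ<-split a (suc κ + c) f) ⟩
  Σ< (a + (suc κ + c)) f                             ≡⟨ cong (λ l → Σ< l f) length ⟩
  Σ< (suc n) f ∎
  where
  open ≤-Reasoning
  f = λ i → inWindow κ a i * x i
  c = n ∸ (a + κ)
  lemma : ∀ a κ c → a + (suc κ + c) ≡ suc (a + κ + c)
  lemma = solve-∀
  length : a + (suc κ + c) ≡ suc n
  length = trans (lemma a κ c) (cong suc (m+[n∸m]≡n a+κ≤n))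

-- Weak duality: Y (a + 1) ∸ Y a is the dual variable of the window a, …, a + κ.
module _ (κ n N : ℕ) (x Y w : ℕ → ℕ) (Y0 : Y 0 ≡ 0)
  (Y-mono : ∀ a → a ≤ n → Y a ≤ Y (suc a))
  (Y-stable : ∀ a → a ≤ n → n < a + κ → Y (suc a) ≤ Y a)
  (Y-feasible : ∀ i → i ≤ n → Y (suc i) ≤ Y (i ∸ κ) + w i)
  (window : ∀ a → a + κ ≤ n → N ≤ Σ< (suc κ) (λ j → x (a + j))) where

  private
    y : ℕ → ℕ
    y a = Y (suc a) ∸ Y a

    telescope : ∀ a d → a + d ≤ suc n → Y a + Σ< d (λ j → y (a + j)) ≡ Y (a + d)
    telescope a zero _ = trans (+-identityʳ _) (cong Y (sym (+-identityʳ a)))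
    telescope a (suc d) h = begin
      Y a + Σ< (suc d) (λ j → y (a + j))      ≡⟨ cong (Y a +_) (Σ<-snoc d (λ j → y (a + j))) ⟩
      Y a + (Σ< d (λ j → y (a + j)) + y (a + d)) ≡⟨ sym (+-assoc (Y a) _ _) ⟩
      Y a + Σ< d (λ j → y (a + j)) + y (a + d) ≡⟨ cong (_+ y (a + d)) (telescope a d (≤-trans (+-monoʳ-≤ a (n≤1+n d)) h)) ⟩
      Y (a + d) + y (a + d)                    ≡⟨ m+[n∸m]≡n (Y-mono (a + d) (s≤s⁻¹ (subst (_≤ suc n) (+-suc a d) h))) ⟩
      Y (suc (a + d))                          ≡⟨ cong Y (sym (+-suc a d)) ⟩
      Y (a + suc d) ∎
      where open ≡-Reasoning

    -- Only windows starting between i - κ and i contain level i, and their dual variables telescope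
    -- to `Y (suc i)` minus `Y (i ∸ κ)`. Hence `Y-feasible` is the dual constraint at level i.
    feasible : ∀ i → i ≤ n → Σ< (suc n) (λ a → y a * inWindow κ a i) ≤ w i
    feasible i i≤n = +-cancelˡ-≤ (Y l) _ _ (begin
      Y l + Σ< (suc n) f
        ≡⟨ cong (λ s → Y l + Σ< s f) (sym length) ⟩
      Y l + Σ< (l + (d + (n ∸ i))) f
        ≡⟨ cong (Y l +_) (trans (Σ<-split l (d + (n ∸ i)) f) (cong₂ _+_ before (Σ<-split d (n ∸ i) (λ j → f (l + j))))) ⟩
      Y l + (Σ< d (λ j → f (l + j)) + Σ< (n ∸ i) (λ j → f (l + (d + j))))
        ≡⟨ cong (λ s → Y l + (Σ< d (λ j → f (l + j)) + s)) after ⟩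
      Y l + (Σ< d (λ j → f (l + j)) + 0)
        ≤⟨ +-monoʳ-≤ (Y l) (≤-trans (≤-reflexive (+-identityʳ _)) (Σ<-mono d λ j _ →
             ≤-trans (*-monoʳ-≤ (y (l + j)) (inWindow≤1 κ (l + j) i)) (≤-reflexive (*-identityʳ _)))) ⟩
      Y l + Σ< d (λ j → y (l + j))
        ≡⟨ telescope l d (≤-trans (≤-reflexive l+d) (s≤s i≤n)) ⟩
      Y (l + d)
        ≡⟨ cong Y l+d ⟩
      Y (suc i)
        ≤⟨ Y-feasible i i≤n ⟩
      Y l + w i ∎)
      where
      open ≤-Reasoning
      f = λ a → y a * inWindow κ a i
      l = i ∸ κ
      d = suc i ∸ l
      l+d : l + d ≡ suc i
      l+d = m+[n∸m]≡n (m≤n⇒m≤1+n (m∸n≤m i κ))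
      length : l + (d + (n ∸ i)) ≡ suc n
      length = trans (sym (+-assoc l d _)) (trans (cong (_+ (n ∸ i)) l+d) (cong suc (m+[n∸m]≡n i≤n)))
      before : Σ< l f ≡ 0
      before = Σ<-zero l λ a a<l → trans (cong (y a *_) (inWindow-> κ
        (subst (a + κ <_) (m∸n+n≡m (<⇒≤ (m∸n≢0⇒n<m {i} {κ} λ e → n≮0 {a} (subst (a <_) e a<l)))) (+-monoˡ-< κ a<l))))
        (*-zeroʳ (y a))
      after : Σ< (n ∸ i) (λ j → f (l + (d + j))) ≡ 0
      after = Σ<-zero (n ∸ i) λ j _ → trans (cong (y (l + (d + j)) *_) (inWindow-< κ
        (≤-trans (≤-reflexive (sym l+d)) (≤-trans (m≤m+n (l + d) j) (≤-reflexive (+-assoc l d j))))))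
        (*-zeroʳ (y (l + (d + j))))

  weak-duality : N * Y (suc n) ≤ Σ< (suc n) (λ i → w i * x i)
  weak-duality = begin
    N * Y (suc n)
      ≡⟨ cong (N *_) (sym (trans (cong (_+ Σ< (suc n) y) (sym Y0)) (telescope 0 (suc n) ≤-refl))) ⟩
    N * Σ< (suc n) y
      ≡⟨ sym (Σ<-* (suc n) N y) ⟩
    Σ< (suc n) (λ a → N * y a)
      ≤⟨ Σ<-mono (suc n) (λ a a<1+n → row a (s≤s⁻¹ a<1+n)) ⟩
    Σ< (suc n) (λ a → Σ< (suc n) (λ i → y a * (inWindow κ a i * x i)))
      ≡⟨ Σ<-swap (suc n) (suc n) (λ a i → y a * (inWindow κ a i * x i)) ⟩
    Σ< (suc n) (λ i → Σ< (suc n) (λ a → y a * (inWindow κ a i * x i)))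
      ≤⟨ Σ<-mono (suc n) (λ i i<1+n → column i (s≤s⁻¹ i<1+n)) ⟩
    Σ< (suc n) (λ i → w i * x i) ∎
    where
    open ≤-Reasoning
    shuffle : ∀ a b c → a * (b * c) ≡ c * (a * b)
    shuffle = solve-∀
    row : ∀ a → a ≤ n → N * y a ≤ Σ< (suc n) (λ i → y a * (inWindow κ a i * x i))
    row a a≤n with a + κ ≤? n
    ... | yes a+κ≤n = ≤-trans (*-monoˡ-≤ (y a) (≤-trans (window a a+κ≤n) (Σ-inWindow κ n a x a+κ≤n)))
      (≤-reflexive (trans (*-comm _ (y a)) (sym (Σ<-* (suc n) (y a) (λ i → inWindow κ a i * x i)))))
    -- A window that sticks out above level n has dual variable 0 by `Y-stable`.
    ... | no ≰ = ≤-trans (≤-reflexive (trans (cong (N *_) (m≤n⇒m∸n≡0 (Y-stable a a≤n (≰⇒> ≰)))) (*-zeroʳ N))) z≤n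
    column : ∀ i → i ≤ n → Σ< (suc n) (λ a → y a * (inWindow κ a i * x i)) ≤ w i * x i
    column i i≤n = ≤-trans (≤-reflexive (trans (Σ<-cong (suc n) λ a _ → shuffle (y a) (inWindow κ a i) (x i))
        (Σ<-* (suc n) (x i) (λ a → y a * inWindow κ a i))))
      (≤-trans (*-monoʳ-≤ (x i) (feasible i i≤n)) (≤-reflexive (*-comm (x i) (w i))))

-- An explicit dual solution

-- The terms are compared one by one by `choose-mono`, starting with the largest, for which the
-- numerical hypothesis is what is needed. The bound f on i makes the recursion from i to i - k
-- structural.
lowerSum-suc : ∀ κ n f i → i ≤ f → suc (i + i) ≤ n + (suc κ + suc κ) → lowerSum κ n i ≤ lowerSum κ n (suc i)
lowerSum-suc κ n f i i≤f h with i ≤? κ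
... | yes i≤κ = ≤-trans (≤-reflexive (lowerSum-small κ n i≤κ)) z≤n
lowerSum-suc κ n zero i i≤f h | no i≰κ = contradiction (≤-trans i≤f z≤n) i≰κ
lowerSum-suc κ n (suc f) i i≤f h | no i≰κ = subst (λ j → lowerSum κ n j ≤ lowerSum κ n (suc j)) i′+k
  (subst₂ _≤_ (sym (lowerSum-step κ n i′)) (sym (lowerSum-step κ n (suc i′)))
    (+-mono-≤ (lowerSum-suc κ n f i′ (s≤s⁻¹ (≤-trans (+-monoˡ-≤ i′ (s≤s (z≤n {κ}))) (≤-trans (≤-reflexive (trans (+-comm (suc κ) i′) i′+k)) i≤f)))
        (m≤n⇒m≤n+o (suc κ + suc κ) 2i′<n)) (choose-mono i′ 2i′<n)))
  where
  i′ = i ∸ suc κ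
  i′+k : i′ + suc κ ≡ i
  i′+k = m∸n+n≡m (≰⇒> i≰κ)
  lemma : ∀ i k → suc (i + k + (i + k)) ≡ suc (i + i) + (k + k)
  lemma = solve-∀
  2i′<n : suc (i′ + i′) ≤ n
  2i′<n = +-cancelʳ-≤ (suc κ + suc κ) _ _ (≤-trans (≤-reflexive
    (trans (sym (lemma i′ (suc κ))) (cong (λ j → suc (j + j)) i′+k))) h)

lowerSum-mono : ∀ κ n i d → (i + d) + (i + d) ≤ suc (n + (suc κ + suc κ)) → lowerSum κ n i ≤ lowerSum κ n (i + d)
lowerSum-mono κ n i zero h = ≤-reflexive (cong (lowerSum κ n) (sym (+-identityʳ i)))
lowerSum-mono κ n i (suc d) h = ≤-trans
  (lowerSum-mono κ n i d (≤-trans (+-mono-≤ i+d≤ i+d≤) h))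
  (≤-trans (lowerSum-suc κ n (i + d) (i + d) ≤-refl
    (s≤s⁻¹ (≤-trans (≤-reflexive (sym (lemma i d))) h)))
    (≤-reflexive (cong (lowerSum κ n) (sym (+-suc i d)))))
  where
  i+d≤ = +-monoʳ-≤ i (n≤1+n d)
  lemma : ∀ i d → i + suc d + (i + suc d) ≡ suc (suc (i + d + (i + d)))
  lemma = solve-∀

-- With k = κ + 1 the two bounds say that m is (n - k)/2 rounded up.
module _ (κ n m : ℕ) (lo : n ≤ m + m + suc κ) (hi : m + m + suc κ ≤ suc n) where

  private
    G : ℕ → ℕ
    G = lowerSum κ n
    σ : ℕ
    σ = classSum κ n m

    2m+κ≤n : m + m + κ ≤ n
    2m+κ≤n = s≤s⁻¹ (≤-trans (≤-reflexive (sym (+-suc (m + m) κ))) hi)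
    2m≤n : m + m ≤ n
    2m≤n = ≤-trans (m≤m+n (m + m) κ) 2m+κ≤n
    m≤n : m ≤ n
    m≤n = ≤-trans (m≤m+n m m) 2m≤n

    -- The total of the dual variables of the windows starting below b. The first branch makes the
    -- constraints at the levels up to m tight, the second one, its reflection, those above m + κ;
    -- both agree at b = m + 1 by `σ-split`.
    dual : ℕ → ℕ
    dual b with b ≤? suc m
    ... | yes _ = G (b + κ)
    ... | no _ = σ ∸ G (suc n ∸ b)

    dual-low : ∀ {b} → b ≤ suc m → dual b ≡ G (b + κ)
    dual-low {b} b≤ with b ≤? suc m
    ... | yes _ = refl
    ... | no ≰ = contradiction b≤ ≰

    σ-split : G m + (n C m) + G (n ∸ m) ≡ σ
    σ-split = sym (classSum-split κ m (n ∸ m) (m+[n∸m]≡n m≤n))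

    G≤σ : ∀ {b} → suc m ≤ b → b ≤ suc n → G (suc n ∸ b) ≤ σ
    G≤σ {b} m<b b≤ = ≤-trans (lowerSum-mono κ n (suc n ∸ b) (b ∸ suc m) (≤-trans
        (≤-reflexive (cong (λ i → i + i) e)) (≤-trans bound (n≤1+n _))))
      (≤-trans (≤-reflexive (cong G e)) (≤-trans (m≤n+m (G (n ∸ m)) _) (≤-reflexive σ-split)))
      where
      e : suc n ∸ b + (b ∸ suc m) ≡ n ∸ m
      e = trans (sym (+-∸-assoc (suc n ∸ b) m<b)) (cong (_∸ suc m) (m∸n+n≡m b≤))
      lemma : ∀ x m → x + x + (m + m) ≡ (x + m) + (x + m)
      lemma = solve-∀
      bound : (n ∸ m) + (n ∸ m) ≤ n + (suc κ + suc κ)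
      bound = +-cancelʳ-≤ (m + m) _ _ (≤-trans (≤-reflexive (trans (lemma (n ∸ m) m)
          (cong (λ x → x + x) (m∸n+n≡m m≤n))))
        (≤-trans (+-monoʳ-≤ n (≤-trans lo (+-monoʳ-≤ (m + m) (m≤m+n (suc κ) (suc κ)))))
          (≤-reflexive (lemma₂ n (m + m) (suc κ + suc κ)))))
        where
        lemma₂ : ∀ a b c → a + (b + c) ≡ a + c + b
        lemma₂ = solve-∀

    dual-high : ∀ {b} → suc m ≤ b → b ≤ suc n → dual b + G (suc n ∸ b) ≡ σ
    dual-high {b} m<b b≤ with b ≤? suc m
    ... | no _ = m∸n+n≡m (G≤σ m<b b≤)
    ... | yes b≤m with ≤-antisym b≤m m<b
    ... | refl = trans (cong (_+ G (n ∸ m)) (trans (cong G (sym (+-suc m κ))) (lowerSum-step κ n m))) σ-split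

    -- For i < κ the truncated argument is 0, but then both sides are 0.
    dual-low∸ : ∀ {i} → i ≤ suc m + κ → dual (i ∸ κ) ≡ G i
    dual-low∸ {i} i≤ = trans (dual-low (m≤n+o⇒m∸n≤o i κ (≤-trans i≤ (≤-reflexive (+-comm (suc m) κ))))) (case (≤-total κ i))
      where
      case : _ → G (i ∸ κ + κ) ≡ G i
      case (inj₁ κ≤i) = cong G (m∸n+n≡m κ≤i)
      case (inj₂ i≤κ) = trans (lowerSum-small κ n (≤-reflexive (cong (_+ κ) (m≤n⇒m∸n≡0 i≤κ))))
        (sym (lowerSum-small κ n i≤κ))

    dual-mono : ∀ a → a ≤ n → dual a ≤ dual (suc a)
    dual-mono a a≤n with a ≤? m
    ... | yes a≤m = subst₂ _≤_ (sym (dual-low (m≤n⇒m≤1+n a≤m))) (sym (dual-low (s≤s a≤m)))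
      (lowerSum-suc κ n _ (a + κ) ≤-refl (≤-trans (≤-reflexive (lemma a κ))
        (≤-trans (+-monoˡ-≤ (κ + suc κ) (≤-trans (+-mono-≤ a≤m a≤m) 2m≤n)) (+-monoʳ-≤ n (n≤1+n _)))))
      where
      lemma : ∀ a κ → suc (a + κ + (a + κ)) ≡ a + a + (κ + suc κ)
      lemma = solve-∀
    ... | no a≰m = +-cancelʳ-≤ (G (suc n ∸ a)) _ _ (begin
        dual a + G (suc n ∸ a)        ≡⟨ dual-high m<a (m≤n⇒m≤1+n a≤n) ⟩
        σ                             ≡⟨ sym (dual-high (m≤n⇒m≤1+n m<a) (s≤s a≤n)) ⟩
        dual (suc a) + G (n ∸ a)      ≤⟨ +-monoʳ-≤ (dual (suc a)) (lowerSum-suc κ n _ (n ∸ a) ≤-refl bound) ⟩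
        dual (suc a) + G (suc (n ∸ a)) ≡⟨ cong (λ j → dual (suc a) + G j) (sym (+-∸-assoc 1 a≤n)) ⟩
        dual (suc a) + G (suc n ∸ a)  ∎)
      where
      open ≤-Reasoning
      m<a = ≰⇒> a≰m
      lemma : ∀ x m → suc (x + x) + (m + m) ≤ (x + suc m) + (x + suc m)
      lemma x m = ≤-trans (n≤1+n _) (≤-reflexive (identity x m))
        where
        identity : ∀ x m → suc (suc (x + x) + (m + m)) ≡ (x + suc m) + (x + suc m)
        identity = solve-∀
      lemma₂ : ∀ a b c → a + (b + c) ≡ a + c + b
      lemma₂ = solve-∀
      x+m≤n : n ∸ a + suc m ≤ n
      x+m≤n = ≤-trans (+-monoʳ-≤ (n ∸ a) m<a) (≤-reflexive (m∸n+n≡m a≤n))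
      bound : suc ((n ∸ a) + (n ∸ a)) ≤ n + (suc κ + suc κ)
      bound = +-cancelʳ-≤ (m + m) _ _ (≤-trans (lemma (n ∸ a) m) (≤-trans (+-mono-≤ x+m≤n x+m≤n)
        (≤-trans (+-monoʳ-≤ n (≤-trans lo (+-monoʳ-≤ (m + m) (m≤m+n (suc κ) (suc κ)))))
          (≤-reflexive (lemma₂ n (m + m) (suc κ + suc κ))))))

    -- Such an a satisfies n + 1 - a ≤ κ, where `G` vanishes, so `dual` has already reached its
    -- final value σ.
    dual-stable : ∀ a → a ≤ n → n < a + κ → dual (suc a) ≤ dual a
    dual-stable a a≤n n<a+κ = begin
      dual (suc a)                ≤⟨ m≤m+n _ (G (n ∸ a)) ⟩
      dual (suc a) + G (n ∸ a)    ≡⟨ dual-high (m≤n⇒m≤1+n m<a) (s≤s a≤n) ⟩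
      σ                           ≡⟨ sym (dual-high m<a (m≤n⇒m≤1+n a≤n)) ⟩
      dual a + G (suc n ∸ a)      ≡⟨ cong (dual a +_) (lowerSum-small κ n (m≤n+o⇒m∸n≤o (suc n) a n<a+κ)) ⟩
      dual a + 0                  ≡⟨ +-identityʳ _ ⟩
      dual a                      ∎
      where
      open ≤-Reasoning
      m<a : suc m ≤ a
      m<a = +-cancelʳ-≤ κ _ _ (≤-trans (≤-reflexive (sym (+-suc m κ)))
        (≤-trans (+-monoˡ-≤ (suc κ) (m≤m+n m m)) (≤-trans hi n<a+κ)))

    -- There is equality at the levels up to m and above m + κ. In between, after adding
    -- `G (n ∸ i)`, the constraint reads σ ≤ `classSum κ n i`, which is the minimality of the class
    -- of m.
    dual-feasible : ∀ i → i ≤ n → dual (suc i) ≤ dual (i ∸ κ) + (n C i)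
    dual-feasible i i≤n with i ≤? m
    ... | yes i≤m = ≤-reflexive (trans (dual-low (s≤s i≤m)) (trans (cong G (sym (+-suc i κ)))
      (trans (lowerSum-step κ n i) (cong (_+ (n C i))
        (sym (dual-low∸ (≤-trans i≤m (≤-trans (n≤1+n m) (m≤m+n (suc m) κ)))))))))
    ... | no i≰m with i ≤? m + κ
    ...   | yes i≤m+κ = +-cancelʳ-≤ (G (n ∸ i)) _ _ (begin
        dual (suc i) + G (n ∸ i)               ≡⟨ dual-high (m≤n⇒m≤1+n m<i) (s≤s i≤n) ⟩
        σ                                      ≤⟨ classSum-min κ n (<⇒≤ m<i) (≤-trans i≤m+κ (+-monoʳ-≤ m (n≤1+n κ)))
                                                    (≤-trans (+-monoʳ-≤ m i≤m+κ) (≤-trans (≤-reflexive (sym (+-assoc m m κ))) 2m+κ≤n))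
                                                    (≤-trans lo (+-monoˡ-≤ (suc κ) (+-monoʳ-≤ m (<⇒≤ m<i)))) ⟩
        classSum κ n i                         ≡⟨ classSum-split κ i (n ∸ i) (m+[n∸m]≡n i≤n) ⟩
        G i + (n C i) + G (n ∸ i)              ≡⟨ cong (λ g → g + (n C i) + G (n ∸ i))
                                                    (sym (dual-low∸ (≤-trans i≤m+κ (n≤1+n _)))) ⟩
        dual (i ∸ κ) + (n C i) + G (n ∸ i)     ∎)
      where
      open ≤-Reasoning
      m<i = ≰⇒> i≰m
    ...   | no i≰m+κ = ≤-reflexive (+-cancelʳ-≡ (G (n ∸ i)) _ _ (begin
        dual (suc i) + G (n ∸ i)               ≡⟨ dual-high (m≤n⇒m≤1+n (≰⇒> i≰m)) (s≤s i≤n) ⟩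
        σ                                      ≡⟨ sym (dual-high m<i∸κ (≤-trans (m∸n≤m i κ) (m≤n⇒m≤1+n i≤n))) ⟩
        dual (i ∸ κ) + G (suc n ∸ (i ∸ κ))     ≡⟨ cong (λ j → dual (i ∸ κ) + G j) reflect ⟩
        dual (i ∸ κ) + G (n ∸ i + suc κ)       ≡⟨ cong (dual (i ∸ κ) +_) (lowerSum-step κ n (n ∸ i)) ⟩
        dual (i ∸ κ) + (G (n ∸ i) + (n C (n ∸ i))) ≡⟨ cong (λ c → dual (i ∸ κ) + (G (n ∸ i) + c)) (sym (nCk≡nC[n∸k] i≤n)) ⟩
        dual (i ∸ κ) + (G (n ∸ i) + (n C i))   ≡⟨ shuffle (dual (i ∸ κ)) (G (n ∸ i)) (n C i) ⟩
        dual (i ∸ κ) + (n C i) + G (n ∸ i)     ∎))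
      where
      open ≡-Reasoning
      κ≤i : κ ≤ i
      κ≤i = ≤-trans (m≤n+m κ m) (<⇒≤ (≰⇒> i≰m+κ))
      m<i∸κ : suc m ≤ i ∸ κ
      m<i∸κ = m+n≤o⇒m≤o∸n (suc m) (≰⇒> i≰m+κ)
      shuffle : ∀ a b c → a + (b + c) ≡ a + c + b
      shuffle = solve-∀
      split : ∀ a b c → a + suc c + b ≡ suc (a + (b + c))
      split = solve-∀
      reflect : suc n ∸ (i ∸ κ) ≡ n ∸ i + suc κ
      reflect = trans (cong (_∸ (i ∸ κ)) (sym (trans (split (n ∸ i) (i ∸ κ) κ)
        (cong suc (trans (cong (n ∸ i +_) (m∸n+n≡m κ≤i)) (m∸n+n≡m i≤n)))))) (m+n∸n≡m (n ∸ i + suc κ) (i ∸ κ))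

  -- Weak duality with the final value `dual (suc n)`, which is σ. The bound is attained when x is N
  -- on the levels congruent to m and 0 elsewhere.
  covering-bound : ∀ N x → (∀ a → a + κ ≤ n → N ≤ Σ< (suc κ) (λ j → x (a + j))) →
    N * classSum κ n m ≤ Σ< (suc n) (λ i → (n C i) * x i)
  covering-bound N x window = subst (λ s → N * s ≤ Σ< (suc n) (λ i → (n C i) * x i)) dual-total
    (weak-duality κ n N x dual (n C_) (trans (dual-low z≤n) (lowerSum-small κ n ≤-refl))
      dual-mono dual-stable dual-feasible window)
    where
    dual-total : dual (suc n) ≡ σ
    dual-total = trans (sym (+-identityʳ _)) (trans (cong (λ j → dual (suc n) + G j) (sym (n∸n≡0 n)))
      (dual-high (s≤s m≤n) ≤-refl))

-- Missing sets

countList-++ : ∀ {n} (𝓕 : Family n) xs ys → countList 𝓕 (xs ++ ys) ≡ countList 𝓕 xs + countList 𝓕 ys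
countList-++ 𝓕 [] ys = refl
countList-++ 𝓕 (A ∷ xs) ys =
  trans (cong (♯ (𝓕 A) +_) (countList-++ 𝓕 xs ys)) (sym (+-assoc (♯ (𝓕 A)) _ _))

countList-map : ∀ {n} (𝓕 : Family (suc n)) b xs →
  countList 𝓕 (map (b ∷_) xs) ≡ countList (𝓕 ∘ (b ∷_)) xs
countList-map 𝓕 b [] = refl
countList-map 𝓕 b (A ∷ xs) = cong (♯ (𝓕 (b ∷ A)) +_) (countList-map 𝓕 b xs)

size-total : ∀ {n} (𝓕 : Family n) → size 𝓕 ≡ total (♯ ∘ 𝓕)
size-total {zero} 𝓕 = +-identityʳ _
size-total {suc n} 𝓕 = trans (countList-++ 𝓕 (map (true ∷_) (allSubsets n)) _) (cong₂ _+_
  (trans (countList-map 𝓕 true (allSubsets n)) (size-total (𝓕 ∘ (true ∷_))))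
  (trans (countList-map 𝓕 false (allSubsets n)) (size-total (𝓕 ∘ (false ∷_)))))

total-♯+miss : ∀ {n} (𝓕 : Family n) → total (♯ ∘ 𝓕) + total (miss 𝓕) ≡ 2 ^ n
total-♯+miss {zero} 𝓕 = ♯+miss 𝓕 []
total-♯+miss {suc n} 𝓕 = trans (shuffle (total (♯ ∘ 𝓕 ∘ (true ∷_))) _ _ _)
  (cong₂ _+_ (total-♯+miss (𝓕 ∘ (true ∷_)))
    (trans (total-♯+miss (𝓕 ∘ (false ∷_))) (sym (+-identityʳ _))))
  where
  shuffle : ∀ a b c d → a + b + (c + d) ≡ a + c + (b + d)
  shuffle = solve-∀

size-miss : ∀ {n} (𝓕 : Family n) → size 𝓕 ≡ 2 ^ n ∸ total (miss 𝓕)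
size-miss 𝓕 = trans (size-total 𝓕) (trans (sym (m+n∸n≡m _ (total (miss 𝓕))))
  (cong (_∸ total (miss 𝓕)) (total-♯+miss 𝓕)))

suc-% : ∀ κ n → 0 < κ → suc n % suc κ ≢ n % suc κ
suc-% (suc κ) n _ e
  with %-cancelˡ-+ (suc κ) n {1} {0} (subst₂ (λ a b → a % (2 + κ) ≡ b % (2 + κ)) (+-comm 1 n) (sym (+-identityʳ n)) e)
... | ()

residueSum : ℕ → ℕ → ℕ → ℕ → ℕ
residueSum n j r zero = 0
residueSum n j r (suc i) with (i % (2 + j)) ≟ (r % (2 + j))
... | yes _ = n C i + residueSum n j r i
... | no _ = residueSum n j r i

-- The left-hand side of go≡residueSum is the local function of S, which cannot be
-- named; unification in S≡residueSum determines it.  There n + 1 is abstracted so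
-- that the two arguments coming from n become independent.
mutual
  go≡residueSum : ∀ n j r i → _ ≡ residueSum n j r i

  S≡residueSum : ∀ n j r → S (suc n) (2 + j) r ≡ residueSum (suc n) j r (2 + n)
  S≡residueSum n j r with (suc n % (2 + j)) ≟ (r % (2 + j))
  S≡residueSum n j r | yes e with (n % (2 + j)) ≟ (r % (2 + j))
  S≡residueSum n j r | yes e | yes e′ = contradiction (trans e (sym e′)) (suc-% (suc j) n z<s)
  S≡residueSum n j r | yes _ | no _ with suc n
  ... | n+1 = cong₂ _+_ refl (go≡residueSum n+1 j r n)
  S≡residueSum n j r | no _ with (n % (2 + j)) ≟ (r % (2 + j))
  S≡residueSum n j r | no _ | yes _ with suc n
  ... | n+1 = cong₂ _+_ refl (go≡residueSum n+1 j r n)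
  S≡residueSum n j r | no _ | no _ with suc n
  ... | n+1 = go≡residueSum n+1 j r n

  go≡residueSum n j r zero = refl
  go≡residueSum n j r (suc i) with (i % (2 + j)) ≟ (r % (2 + j))
  ... | yes _ = cong ((n C i) +_) (go≡residueSum n j r i)
  ... | no _ = go≡residueSum n j r i

residueSum-Σ : ∀ n j r i → residueSum n j r i ≡ Σ< i (λ l → ρ (suc j) l r * (n C l))
residueSum-Σ n j r zero = refl
residueSum-Σ n j r (suc i) = trans step (sym (Σ<-snoc i (λ l → ρ (suc j) l r * (n C l))))
  where
  step : residueSum n j r (suc i) ≡ Σ< i (λ l → ρ (suc j) l r * (n C l)) + ρ (suc j) i r * (n C i)
  step with (i % (2 + j)) ≟ (r % (2 + j))
  ... | yes _ = trans (+-comm (n C i) _) (cong₂ _+_ (residueSum-Σ n j r i) (sym (+-identityʳ _)))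
  ... | no _ = trans (residueSum-Σ n j r i) (sym (+-identityʳ _))

S≡classSum : ∀ n j r → 1 ≤ n → S n (2 + j) r ≡ classSum (suc j) n r
S≡classSum (suc n) j r _ = trans (S≡residueSum n j r) (residueSum-Σ (suc n) j r (2 + n))

-- Lower bounds for the number of missing sets

module _ {n : ℕ} (𝓕 : Family n) where

  levelWeight-choose : ∀ i → i ≤ n → (n C i) * levelWeight 𝓕 i ≡ n ! * levelSum i (miss 𝓕)
  levelWeight-choose i i≤n = trans (shuffle (n C i) (levelSum i (miss 𝓕)) (i ! * (n ∸ i) !))
    (cong (_* levelSum i (miss 𝓕)) (choose-! i (n ∸ i) (m+[n∸m]≡n i≤n)))
    where
    shuffle : ∀ a b c → a * (b * c) ≡ a * c * b
    shuffle = solve-∀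

  Σ-levelWeight : Σ< (suc n) (λ i → (n C i) * levelWeight 𝓕 i) ≡ n ! * total (miss 𝓕)
  Σ-levelWeight = trans (Σ<-cong (suc n) λ i i<1+n → levelWeight-choose i (s≤s⁻¹ i<1+n))
    (trans (Σ<-* (suc n) (n !) (λ i → levelSum i (miss 𝓕))) (cong (n ! *_) (Σ-levelSum (miss 𝓕))))

-- With modulus n = ν + 1 the class of 0 consists of the levels 0 and n. The value 2 serves both as
-- the total correction at the two boundary levels and as the optimum for n = k.
classSum-ends : ∀ ν → classSum ν (suc ν) 0 ≡ 2
classSum-ends ν = trans (classSum-split ν 0 (suc ν) refl) (cong₂ _+_ (nC0≡1 (suc ν))
  (trans (lowerSum-step ν (suc ν) 0) (nC0≡1 (suc ν))))

term≤Σ< : ∀ n f {i} → i < n → f i ≤ Σ< n f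
term≤Σ< (suc n) f {zero} _ = m≤m+n _ _
term≤Σ< (suc n) f {suc i} (s≤s i<n) = ≤-trans (term≤Σ< n (f ∘ suc) i<n) (m≤n+m _ _)

-- Only the bottom and the top window fall short, by n!/D each, so it suffices to add
-- n!/D to the weights of the levels 0 and n; since D ≥ 3 this costs less than one set.
missing-≥ : ∀ {ν r} (𝓕 : Family (suc ν)) → Free (3 + r) 𝓕 → 3 + r ≤ ν → ∀ m →
  suc ν ≤ m + m + (3 + r) → m + m + (3 + r) ≤ suc (suc ν) →
  classSum (2 + r) (suc ν) m ≤ total (miss 𝓕)
missing-≥ {ν} {r} 𝓕 free k≤ν m lo hi = ≮⇒≥ λ μ<s → <⇒≱ 3≤D (+-cancelˡ-≤ (D * μ) _ _
  (≤-trans (≤-reflexive (trans (+-comm (D * μ) D) (sym (*-suc D μ)))) (≤-trans (*-monoʳ-≤ D μ<s) main)))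
  where
  n = suc ν
  κ = 2 + r
  -- This is p q for the bottom window, where p = 1, and for the top window, where q = 1.
  D = suc n ∸ κ
  μ = total (miss 𝓕)
  s = classSum κ n m
  LW = levelWeight 𝓕
  x : ℕ → ℕ
  -- Modulo n the factor `ρ ν i 0` marks just the levels 0 and n; everything is scaled by D to stay
  -- within the naturals.
  x i = D * LW i + n ! * ρ ν i 0
  3≤D : 3 ≤ D
  3≤D = m+n≤o⇒m≤o∸n 3 (s≤s (s≤s k≤ν))
  Σx : ∀ l a → Σ< l (λ j → x (a + j)) ≡ D * Σ< l (λ j → LW (a + j)) + n ! * Σ< l (λ j → ρ ν (a + j) 0)
  Σx l a = Σ<-linear l D (λ j → LW (a + j)) (n !) (λ j → ρ ν (a + j) 0)

  -- An interior window has δ = 0, and its factor p q cancels. A boundary window has D = p q, and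
  -- its loss is covered by the n! added at level 0 or n.
  middle : ∀ a q δ → suc a + suc q ≤ suc a * suc q + δ → suc a + (r + suc q) ≡ n →
    δ * n ! ≤ n ! * Σ< (3 + r) (λ j → ρ ν (a + j) 0) → (δ ≡ 0 ⊎ D ≡ suc a * suc q) →
    D * n ! ≤ Σ< (3 + r) (λ j → x (a + j))
  middle a q δ h e slack (inj₁ refl) = ≤-trans
    (*-monoʳ-≤ D (*-cancelˡ-≤ (suc a * suc q) (≤-trans (window-inequality free a q 0 h e) (≤-reflexive (+-identityʳ _)))))
    (≤-trans (m≤m+n _ _) (≤-reflexive (sym (Σx (3 + r) a))))
  middle a q δ h e slack (inj₂ D≡) = ≤-trans (≤-reflexive (cong (_* n !) D≡))
    (≤-trans (window-inequality free a q δ h e) (≤-trans (+-monoʳ-≤ _ slack)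
      (≤-reflexive (trans (cong (λ d → d * Σ< (3 + r) (λ j → LW (a + j)) + n ! * Σ< (3 + r) (λ j → ρ ν (a + j) 0)) (sym D≡)) (sym (Σx (3 + r) a))))))

  product : ∀ a q → suc (suc a) + suc (suc q) ≤ suc (suc a) * suc (suc q) + 0
  product a q = ≤-trans (m≤m+n _ (a + q + a * q)) (≤-reflexive (lemma a q))
    where
    lemma : ∀ a q → suc (suc a) + suc (suc q) + (a + q + a * q) ≡ suc (suc a) * suc (suc q) + 0
    lemma = solve-∀

  window : ∀ a → a + κ ≤ n → D * n ! ≤ Σ< (3 + r) (λ j → x (a + j))
  window a a+κ≤n = go a (n ∸ (a + κ)) (m+[n∸m]≡n a+κ≤n)
    where
    rearrange : ∀ a r q → suc a + (r + suc q) ≡ a + (2 + r) + q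
    rearrange = solve-∀
    slack : ∀ a {j} → j < 3 + r → (a + j) % n ≡ 0 → 1 * n ! ≤ n ! * Σ< (3 + r) (λ j → ρ ν (a + j) 0)
    slack a {j} j<k e = ≤-trans (≤-reflexive (*-comm 1 (n !))) (*-monoʳ-≤ (n !)
      (≤-trans (≤-reflexive (sym (ρ≡1 ν {a + j} {0} e))) (term≤Σ< (3 + r) (λ j → ρ ν (a + j) 0) j<k)))
    D≡ : ∀ a q → a + κ + q ≡ n → D ≡ suc (a + q)
    D≡ a q e = trans (cong (λ y → suc y ∸ κ) (sym e))
      (trans (cong (_∸ κ) (lemma a κ q)) (m+n∸m≡n κ (suc (a + q))))
      where
      lemma : ∀ a κ q → suc (a + κ + q) ≡ κ + suc (a + q)
      lemma = solve-∀
    go : ∀ a q → a + κ + q ≡ n → D * n ! ≤ Σ< (3 + r) (λ j → x (a + j))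
    go zero q e = middle 0 q 1 (≤-reflexive (lemma q)) (trans (rearrange 0 r q) e)
      (slack 0 {0} z<s refl) (inj₂ (trans (D≡ 0 q e) (sym (+-identityʳ _))))
      where
      lemma : ∀ q → 1 + suc q ≡ 1 * suc q + 1
      lemma = solve-∀
    go (suc a) zero e = middle (suc a) 0 1 (≤-reflexive (lemma a)) (trans (rearrange (suc a) r 0) e)
      (slack (suc a) {κ} (n<1+n κ) (trans (cong (_% n) (trans (sym (+-identityʳ _)) e)) (n%n≡0 n)))
      (inj₂ (trans (D≡ (suc a) 0 e) (lemma₂ a)))
      where
      lemma : ∀ a → suc (suc a) + 1 ≡ suc (suc a) * 1 + 1
      lemma = solve-∀
      lemma₂ : ∀ a → suc (suc a + 0) ≡ suc (suc a) * 1
      lemma₂ = solve-∀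
    go (suc a) (suc q) e = middle (suc a) (suc q) 0 (product a q) (trans (rearrange (suc a) r (suc q)) e)
      z≤n (inj₁ refl)

  main : D * s ≤ D * μ + 2
  main = *-cancelˡ-≤ (n !) {{n !≢0}} (begin
    n ! * (D * s)
      ≡⟨ swap (n !) D s ⟩
    D * n ! * s
      ≤⟨ covering-bound κ n m lo hi (D * n !) x window ⟩
    Σ< (suc n) (λ i → (n C i) * x i)
      ≡⟨ trans (Σ<-cong (suc n) λ i _ → expand (n C i) D (LW i) (n !) (ρ ν i 0))
           (Σ<-linear (suc n) D (λ i → (n C i) * LW i) (n !) (λ i → ρ ν i 0 * (n C i))) ⟩
    D * Σ< (suc n) (λ i → (n C i) * LW i) + n ! * classSum ν n 0
      ≡⟨ cong₂ (λ y z → D * y + n ! * z) (Σ-levelWeight 𝓕) (classSum-ends ν) ⟩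
    D * (n ! * μ) + n ! * 2
      ≡⟨ collect D (n !) μ ⟩
    n ! * (D * μ + 2) ∎)
    where
    open ≤-Reasoning
    swap : ∀ f d s → f * (d * s) ≡ d * f * s
    swap = solve-∀
    expand : ∀ c d l f e → c * (d * l + f * e) ≡ d * (c * l) + f * (e * c)
    expand = solve-∀
    collect : ∀ d f μ → d * (f * μ) + f * 2 ≡ f * (d * μ + 2)
    collect = solve-∀

-- For n = i + d + 2 this bounds the number of maximal chains through a set on an inner level by (n
-- - 1)!.
!-*-≤ : ∀ i d → suc i ! * suc d ! ≤ suc (i + d) !
!-*-≤ zero d = ≤-reflexive (*-identityˡ _)
!-*-≤ (suc i) d = ≤-trans (≤-reflexive (*-assoc (2 + i) (suc i !) _))
  (*-mono-≤ (s≤s (s≤s (m≤m+n i d))) (!-*-≤ i d))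

-- For n = k the correction used in `missing-≥` would cost a whole set. If the empty set and the
-- full set are both missing, the bound is clear. Otherwise take the window of levels 0 to n - 1 or
-- 1 to n whose extreme set is present: n! is at most twice the missing weight on the inner levels,
-- where a set weighs at most (n - 1)!. Hence n ≤ 2 B with n ≥ 3, so B ≥ 2.
missing-≥2 : ∀ {r} (𝓕 : Family (3 + r)) → Free (3 + r) 𝓕 → 2 ≤ total (miss 𝓕)
missing-≥2 {r} 𝓕 free = subst (2 ≤_) μ-split (case (M 0) (M n) refl refl)
  where
  n = 3 + r
  κ = 2 + r
  M : ℕ → ℕ
  M i = levelSum i (miss 𝓕)
  LW = levelWeight 𝓕
  B = Σ< κ (λ j → M (suc j))
  μ-split : M 0 + (B + M n) ≡ total (miss 𝓕)
  μ-split = trans (cong (M 0 +_) (sym (Σ<-snoc κ (λ j → M (suc j))))) (Σ-levelSum (miss 𝓕))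
  LW-≤ : Σ< κ (λ j → LW (suc j)) ≤ κ ! * B
  LW-≤ = ≤-trans (Σ<-mono κ λ j j<κ → ≤-trans (*-monoʳ-≤ (M (suc j)) (bound j j<κ))
    (≤-reflexive (*-comm (M (suc j)) (κ !)))) (≤-reflexive (Σ<-* κ (κ !) (λ j → M (suc j))))
    where
    bound : ∀ j → j < κ → suc j ! * (κ ∸ j) ! ≤ κ !
    bound j j<κ = subst₂ (λ d e → suc j ! * d ! ≤ e !) (sym (+-∸-assoc 1 j<κ)) (m+[n∸m]≡n j<κ)
      (!-*-≤ j (κ ∸ suc j))
  from-weights : n ! ≤ 2 * Σ< κ (λ j → LW (suc j)) → 2 ≤ B
  from-weights h = large B (*-cancelˡ-≤ (κ !) {{κ !≢0}} (≤-trans (≤-reflexive (*-comm (κ !) n))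
    (≤-trans h (≤-trans (*-monoʳ-≤ 2 LW-≤) (≤-reflexive (swap (κ !) B))))))
    where
    swap : ∀ f b → 2 * (f * b) ≡ f * (2 * b)
    swap = solve-∀
    large : ∀ b → n ≤ 2 * b → 2 ≤ b
    large (suc (suc b)) _ = s≤s (s≤s z≤n)
    large (suc zero) (s≤s (s≤s ()))
    large zero ()
  halve : ∀ {f x} → 2 * f ≤ 2 * x + 1 * f → f ≤ 2 * x
  halve {f} {x} h = +-cancelʳ-≤ f _ _ (subst₂ _≤_ (lemma f) (cong (2 * x +_) (*-identityˡ f)) h)
    where
    lemma : ∀ f → 2 * f ≡ f + f
    lemma = solve-∀
  bottom : M 0 ≡ 0 → 2 ≤ B
  bottom M0≡0 = from-weights (≤-trans
    (halve {n !} {Σ< n LW} (window-inequality free 0 1 1 ≤-refl (lemma r)))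
    (≤-reflexive (cong (λ w → 2 * (w * (0 ! * n !) + Σ< κ (λ j → LW (suc j)))) M0≡0)))
    where
    lemma : ∀ r → 1 + (r + 2) ≡ 3 + r
    lemma = solve-∀
  top : M n ≡ 0 → 2 ≤ B
  top Mn≡0 = from-weights (≤-trans
    (halve {n !} {Σ< n (λ j → LW (suc j))} (window-inequality free 1 0 1 ≤-refl (lemma r)))
    (≤-reflexive (cong (2 *_) (trans (Σ<-snoc κ (λ j → LW (suc j)))
      (trans (cong (λ w → Σ< κ (λ j → LW (suc j)) + w * (n ! * (n ∸ n) !)) Mn≡0) (+-identityʳ _))))))
    where
    lemma : ∀ r → 2 + (r + 1) ≡ 3 + r
    lemma = solve-∀
  case : ∀ u v → M 0 ≡ u → M n ≡ v → 2 ≤ M 0 + (B + M n)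
  case zero _ M0≡ _ = ≤-trans (bottom M0≡) (≤-trans (m≤m+n B (M n)) (m≤n+m _ (M 0)))
  case _ zero _ Mn≡ = ≤-trans (top Mn≡) (≤-trans (m≤m+n B (M n)) (m≤n+m _ (M 0)))
  case (suc u) (suc v) M0≡ Mn≡ = +-mono-≤ {1} {_} {1}
    (≤-trans (s≤s z≤n) (≤-reflexive (sym M0≡)))
    (≤-trans (≤-trans (s≤s z≤n) (≤-reflexive (sym Mn≡))) (m≤n+m (M n) B))

-- The extremal family

avoiding : ∀ {n} → ℕ → ℕ → Family n
avoiding κ m A = ρ κ ∣ A ∣ m ≡ᵇ 0

miss-avoiding : ∀ {n} κ m (A : Subset n) → miss (avoiding κ m) A ≡ ρ κ ∣ A ∣ m
miss-avoiding κ m A with (∣ A ∣ % suc κ) ≟ (m % suc κ)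
... | yes _ = refl
... | no _ = refl

total-avoiding : ∀ n κ m → total {n} (miss (avoiding κ m)) ≡ classSum κ n m
total-avoiding n κ m = trans (sym (Σ-levelSum {n} (miss (avoiding κ m)))) (Σ<-cong (suc n) λ i _ →
  trans (levelSum-cong {n} i λ A ∣A∣≡i → trans (miss-avoiding κ m A) (cong (λ l → ρ κ l m) ∣A∣≡i))
    (trans (levelSum-const n i (ρ κ i m)) (*-comm (n C i) _)))

∉-avoiding : ∀ {n} κ m {A : Subset n} → ∣ A ∣ % suc κ ≡ m % suc κ → ¬ (A ∈F avoiding κ m)
∉-avoiding κ m {A} e A∈ with trans (sym A∈) (cong (_≡ᵇ 0) (ρ≡1 κ {∣ A ∣} {m} e))
... | ()

residue-hit : ∀ κ m l → ∃ λ d → d ≤ κ × (l + d) % suc κ ≡ m % suc κ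
-- Modulo κ + 1 the term `κ * l` stands for -l, so d is the residue of m - l.
residue-hit κ m l = (m + κ * l) % suc κ , s≤s⁻¹ (m%n<n (m + κ * l) (suc κ))
  , trans (%-congʳ-+ κ l (m%n%n≡m%n (m + κ * l) (suc κ)))
      (trans (cong (_% suc κ) (lemma κ l m)) ([m+kn]%n≡m%n m l (suc κ)))
  where
  lemma : ∀ κ l m → l + (m + κ * l) ≡ m + l * suc κ
  lemma = solve-∀

avoiding-free : ∀ {n} r m → Free {n} (3 + r) (avoiding (2 + r) m)
avoiding-free {n} r m = noY , noY'
  where
  κ = 2 + r
  noY : ¬ ContainsY (3 + r) (avoiding κ m)
  noY (F₁ , F₂ , G , F₁∈ , _ , G∈ , _ , _ , _ , _ , _ , _ , _ , card)
    with residue-hit κ m ∣ G 0 ∣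
  -- Counted from the level of `G 0`, the offset κ is the level of `F₁`, and every smaller offset d
  -- is the level of `G d`.
  ... | d , d≤κ , e with m≤n⇒m<n∨m≡n d≤κ
  ... | inj₂ refl = ∉-avoiding κ m {F₁} (trans (cong (_% suc κ) (sym (card 0 z<s))) e) F₁∈
  ... | inj₁ d<κ = ∉-avoiding κ m {G d} (trans (cong (_% suc κ) level) e) (G∈ d d<κ)
    where
    level : ∣ G d ∣ ≡ ∣ G 0 ∣ + d
    level = +-cancelʳ-≡ (κ ∸ d) _ _ (trans (card d d<κ) (trans (sym (card 0 z<s))
      (trans (cong (∣ G 0 ∣ +_) (sym (m+[n∸m]≡n d≤κ))) (sym (+-assoc ∣ G 0 ∣ d _)))))
  noY' : ¬ ContainsY' (3 + r) (avoiding κ m)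
  noY' (F₁ , F₂ , G , F₁∈ , _ , G∈ , _ , _ , _ , _ , _ , _ , _ , card)
    with residue-hit κ m ∣ F₁ ∣
  ... | zero , _ , e = ∉-avoiding κ m {F₁} (trans (cong (_% suc κ) (sym (+-identityʳ ∣ F₁ ∣))) e) F₁∈
  -- Here `F₁` lies on the lowest level and the chain descends towards it, so a positive offset
  -- corresponds to the index κ minus that offset.
  ... | suc d , d<κ , e = ∉-avoiding κ m {G (κ ∸ suc d)} (trans (cong (_% suc κ) level) e) (G∈ _ i<κ)
    where
    i<κ : κ ∸ suc d < κ
    i<κ = s≤s (m∸n≤m (suc r) d)
    level : ∣ G (κ ∸ suc d) ∣ ≡ ∣ F₁ ∣ + suc d
    level = trans (card _ i<κ) (cong (∣ F₁ ∣ +_) (m∸[m∸n]≡n d<κ))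

ceilHalf-bounds : ∀ x → x ≤ ceilHalf x + ceilHalf x × ceilHalf x + ceilHalf x ≤ suc x
ceilHalf-bounds x = s≤s⁻¹ (≤-trans (≤-reflexive (+-comm 1 x)) (≤-trans (≤-reflexive division)
    (≤-trans (+-monoˡ-≤ (h * 2) (s≤s⁻¹ (m%n<n (x + 1) 2))) (≤-reflexive (cong suc (double h))))))
  , ≤-trans (≤-reflexive (sym (double h))) (≤-trans (m≤n+m (h * 2) ((x + 1) % 2))
      (≤-reflexive (trans (sym division) (+-comm x 1))))
  where
  h = ceilHalf x
  division : x + 1 ≡ (x + 1) % 2 + h * 2
  division = m≡m%n+[m/n]*n (x + 1) 2
  double : ∀ h → h * 2 ≡ h + h
  double = solve-∀

missing-≥-S : ∀ n r → 3 + r ≤ n → (𝓕 : Family n) → Free (3 + r) 𝓕 →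
  classSum (2 + r) n (ceilHalf (n ∸ (3 + r))) ≤ total (miss 𝓕)
missing-≥-S n r k≤n 𝓕 free with m≤n⇒m<n∨m≡n k≤n
missing-≥-S (suc ν) r k≤n 𝓕 free | inj₁ (s≤s k≤ν) = missing-≥ 𝓕 free k≤ν (ceilHalf x)
    (≤-trans (≤-reflexive (sym (m∸n+n≡m k≤n))) (+-monoˡ-≤ (3 + r) (proj₁ (ceilHalf-bounds x))))
    (≤-trans (+-monoˡ-≤ (3 + r) (proj₂ (ceilHalf-bounds x))) (≤-reflexive (cong suc (m∸n+n≡m k≤n))))
  where
  x = suc ν ∸ (3 + r)
-- For n = k the residue m is 0, and the class sum is that of the levels 0 and n.
missing-≥-S n r k≤n 𝓕 free | inj₂ refl = ≤-trans (≤-reflexive (trans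
  (cong (λ d → classSum (2 + r) (3 + r) (ceilHalf d)) (n∸n≡0 (3 + r))) (classSum-ends (2 + r))))
  (missing-≥2 𝓕 free)

theorem8 : (n k : ℕ) → 3 ≤ k → k ≤ n →
    IsLac n k (2 ^ n ∸ S n k (ceilHalf (n ∸ k)))
theorem8 n (suc (suc (suc r))) _ k≤n =
  (avoiding (2 + r) m , avoiding-free r m
    , trans (size-miss {n} (avoiding (2 + r) m)) (cong (2 ^ n ∸_) (trans (total-avoiding n (2 + r) m) (sym S≡))))
  , λ 𝓕 free → ≤-trans (≤-reflexive (size-miss 𝓕)) (∸-monoʳ-≤ (2 ^ n)
      (≤-trans (≤-reflexive S≡) (missing-≥-S n r k≤n 𝓕 free)))
  where
  m = ceilHalf (n ∸ (3 + r))
  S≡ : S n (3 + r) m ≡ classSum (2 + r) n m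
  S≡ = S≡classSum n (suc r) m (≤-trans (s≤s z≤n) k≤n)
theorem8 n (suc (suc zero)) (s≤s (s≤s ())) _
theorem8 n (suc zero) (s≤s ()) _
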